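{- Let $\mathbf{\Phi}$ be a finite set of $1$-dimensional semialgebraic predicates that is Erdős–Szekeres. Then there exists a number $C=C(\mathbf{\Phi})$ such that for every $n\ge 1$, $$\mathrm{ES}_{\mathbf{\Phi}}(n)\le 2^{2^{Cn}}.$$
   Context: A $d$-dimensional $k$-ary semialgebraic predicate $\Phi(\mathbf{x}_1,\ldots,\mathbf{x}_k)$, $\mathbf{x}_i\in\mathbb{R}^d$, is a Boolean combination of polynomial equations and inequalities (polynomials with rational coefficients) in the $dk$ coordinates of $\mathbf{x}_1,\ldots,\mathbf{x}_k$. For $d=1$ the arguments are real numbers. A $k$-ary predicate $\Phi$ holds everywhere on a sequence $(a_1,\ldots,a_n)$ if $\Phi(a_{i_1},\ldots,a_{i_k})$ holds for every $1\le i_1<i_2<\cdots<i_k\le n$. A finite set $\mathbf{\Phi}$ of predicates (possibly of different arities) is Erdős–Szekeres if for every $n$ there exists $N$ such that every sequence of length $N$ has a subsequence (not necessarily contiguous) of length $n$ on which some $\Phi\in\mathbf{\Phi}$ holds everywhere; $\mathrm{ES}_{\mathbf{\Phi}}(n)$ denotes the smallest such $N$. -}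

module Defs where

open import Data.Nat as ℕ using (ℕ; zero; suc)
open import Data.Integer as ℤ using (ℤ; +_; -[1+_])
open import Data.Rational using (ℚ; mkℚ)
open import Data.Fin as Fin using (Fin)
open import Data.List using (List)
open import Data.List.Relation.Unary.Any using (Any)
open import Data.Product using (Σ; ∃; _×_)
open import Data.Sum using (_⊎_)
open import Relation.Nullary using (¬_)
open import Relation.Binary.PropositionalEquality using (_≡_; _≢_)
open import Algebra.Structures using (IsCommutativeRing)
open import Relation.Binary.Structures using (IsStrictTotalOrder)

-- The real numbers, axiomatised as a complete ordered field.
-- (All models are isomorphic to ℝ; the theorem quantifies over an
-- arbitrary model.)

record RealField : Set₁ where
  infixl 6 _+_
  infixl 7 _*_
  infix 4 _<_ _≤_
  field
    Carrier : Set
    _+_ _*_ : Carrier → Carrier → Carrier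
    -_ : Carrier → Carrier
    _⁻¹ : Carrier → Carrier
    0r 1r : Carrier
    _<_ : Carrier → Carrier → Set
    isCommutativeRing : IsCommutativeRing _≡_ _+_ _*_ -_ 0r 1r
    0≢1 : 0r ≢ 1r
    ⁻¹-inverse : ∀ x → x ≢ 0r → x * (x ⁻¹) ≡ 1r
    isStrictTotalOrder : IsStrictTotalOrder _≡_ _<_
    +-mono-< : ∀ x y z → x < y → x + z < y + z
    *-pos : ∀ x y → 0r < x → 0r < y → 0r < x * y

  _≤_ : Carrier → Carrier → Set
  x ≤ y = x < y ⊎ x ≡ y

  IsUpperBound : (Carrier → Set) → Carrier → Set
  IsUpperBound S b = ∀ x → S x → x ≤ b

  field
    complete : (S : Carrier → Set) → (∃ λ x → S x) → (∃ λ b → IsUpperBound S b) →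
               ∃ λ u → IsUpperBound S u × (∀ b → IsUpperBound S b → u ≤ b)

data Poly (m : ℕ) : Set where
  const : ℚ → Poly m
  var   : Fin m → Poly m
  _⊕_   : Poly m → Poly m → Poly m
  _⊗_   : Poly m → Poly m → Poly m

data Formula (m : ℕ) : Set where
  _≐0   : Poly m → Formula m
  _>0   : Poly m → Formula m
  ¬ᶠ_   : Formula m → Formula m
  _∧ᶠ_  : Formula m → Formula m → Formula m
  _∨ᶠ_  : Formula m → Formula m → Formula m

module Semantics (ℝ : RealField) where
  open RealField ℝ

  fromℕ : ℕ → Carrier
  fromℕ zero = 0r
  fromℕ (suc n) = 1r + fromℕ n

  fromℤ : ℤ → Carrier
  fromℤ (+ n) = fromℕ n
  fromℤ -[1+ n ] = - fromℕ (suc n)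

  fromℚ : ℚ → Carrier
  fromℚ (mkℚ num den-1 _) = fromℤ num * (fromℕ (suc den-1) ⁻¹)

  evalP : ∀ {m} → Poly m → (Fin m → Carrier) → Carrier
  evalP (const q) x = fromℚ q
  evalP (var i) x = x i
  evalP (p ⊕ q) x = evalP p x + evalP q x
  evalP (p ⊗ q) x = evalP p x * evalP q x

  ⟦_⟧ : ∀ {m} → Formula m → (Fin m → Carrier) → Set
  ⟦ p ≐0 ⟧ x = evalP p x ≡ 0r
  ⟦ p >0 ⟧ x = 0r < evalP p x
  ⟦ ¬ᶠ φ ⟧ x = ¬ ⟦ φ ⟧ x
  ⟦ φ ∧ᶠ ψ ⟧ x = ⟦ φ ⟧ x × ⟦ ψ ⟧ x
  ⟦ φ ∨ᶠ ψ ⟧ x = ⟦ φ ⟧ x ⊎ ⟦ ψ ⟧ x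

-- 1-dimensional k-ary semialgebraic predicates: an arity k together
-- with a formula in k real variables.

Predicate : Set
Predicate = Σ ℕ Formula

StrictlyIncreasing : ∀ {k N} → (Fin k → Fin N) → Set
StrictlyIncreasing ι = ∀ i j → i Fin.< j → ι i Fin.< ι j

module ErdosSzekeres (ℝ : RealField) where
  open RealField ℝ
  open Semantics ℝ

  HoldsEverywhere : Predicate → ∀ {N} → (Fin N → Carrier) → Set
  HoldsEverywhere (k Data.Product., φ) {N} a =
    (ι : Fin k → Fin N) → StrictlyIncreasing ι → ⟦ φ ⟧ (λ i → a (ι i))

  Works : List Predicate → ℕ → ℕ → Set
  Works Φs n N = (a : Fin N → Carrier) →
    ∃ λ (σ : Fin n → Fin N) → StrictlyIncreasing σ ×
      Any (λ Φ → HoldsEverywhere Φ (λ i → a (σ i))) Φs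

  IsErdosSzekeres : List Predicate → Set
  IsErdosSzekeres Φs = ∀ n → ∃ λ N → Works Φs n N

  -- ES_Φs(n) ≤ M, i.e. the least N that works is at most M
  ES≤ : List Predicate → ℕ → ℕ → Set
  ES≤ Φs n M = ∃ λ N → N ℕ.≤ M × Works Φs n N

{-# OPTIONS --safe #-}
-- It is enough to find, in every sequence of length 2^(2^(Cn)), n terms on
-- which each of the finitely many polynomials of Φs has constant sign on
-- increasing tuples: by the Erdős–Szekeres property some predicate holds on
-- one tuple of such a subsequence (if it is long enough), hence on all.
--
-- A strictly monotone sequence contains a logarithmically long subsequence
-- x = t ± δ whose distances δ to a fixed t at least double. The same argument
-- in the multiplicative group, applied to δ, gives δ = τ ε or δ = τ / ε where
-- each scale ε exceeds any prescribed power of the preceding one; the two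
-- logarithms account for the two exponentials. A polynomial in x is a
-- polynomial in ε whose coefficients depend on t and τ but whose number of
-- terms and degree do not. Given two monomials, half of the scales can be kept
-- so that one monomial exceeds the other by a large factor on all tuples.
-- After doing this for all pairs, a single monomial dominates the polynomial.

module Submission where

open import Defs
open import Data.Nat as ℕ using (ℕ; zero; suc; z≤n; s≤s)
import Data.Nat.Properties as ℕₚ
import Data.Nat.ListAction as ListAction
open import Data.Nat.ListAction using (product)
import Data.Nat.Solver as ℕ-Solver
open import Data.Fin as Fin using (Fin; zero; suc; opposite; inject₁; inject≤)
import Data.Fin.Properties as Finₚ
open import Data.Vec as Vec using (Vec; []; _∷_; replicate; zipWith; _[_]≔_)
import Data.Vec.Properties as Vecₚ
open import Data.List
  using (List; []; _∷_; _++_; [_]; length; map; foldr; concatMap; lookup; tabulate; allFin; reverse;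
         initLast; _∷ʳ′_; cartesianProduct; cartesianProductWith)
import Data.List.Properties as Listₚ
open import Data.List.Relation.Unary.All as All using (All; []; _∷_; all?)
import Data.List.Relation.Unary.All.Properties as Allₚ
open import Data.List.Relation.Unary.Any using (here; there)
import Data.List.Relation.Unary.Any.Properties as Anyₚ
open import Data.List.Relation.Unary.AllPairs as AllPairs using (AllPairs; []; _∷_)
import Data.List.Relation.Unary.AllPairs.Properties as AllPairsₚ
open import Data.List.Membership.Propositional using (_∈_; find; lose)
open import Data.List.Membership.Propositional.Properties using (∈-lookup; ∈-cartesianProduct⁺; ∈-cartesianProduct⁻)
open import Data.List.Relation.Binary.Permutation.Propositional using (_↭_; ↭-refl; ↭-prep; ↭-swap; ↭-sym; ↭-trans)
open import Data.List.Relation.Binary.Permutation.Propositional.Properties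
  using (∈-resp-↭; ↭-length) renaming (map⁺ to ↭-map⁺)
open import Data.List.Relation.Binary.Sublist.Propositional
  using (_⊆_; []; _∷_; _∷ʳ_; ⊆-refl; ⊆-trans; minimum)
open import Data.List.Relation.Binary.Sublist.Propositional.Properties
  using (All-resp-⊆; ++⁺; ++⁺ˡ; ++⁺ʳ; map⁺; reverse⁺)
open import Data.Product using (∃; ∃₂; Σ; _×_; _,_; proj₁; proj₂)
open import Data.Sum as Sum using (_⊎_; inj₁; inj₂)
open import Data.Empty using (⊥-elim)
open import Function using (_∘_; flip; id)
open import Level using (0ℓ)
open import Relation.Nullary using (¬_; yes; no)
import Relation.Unary as U
open import Relation.Binary using (Rel; Decidable; Transitive; tri<; tri≈; tri>)
open import Relation.Binary.Bundles using (StrictTotalOrder)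
open import Relation.Binary.Structures using (IsStrictTotalOrder)
open import Relation.Binary.PropositionalEquality hiding ([_])
open import Algebra.Bundles using (CommutativeRing)
import Algebra.Properties.CommutativeSemigroup as CommutativeSemigroupProperties
import Algebra.Properties.CommutativeSemiring.Exp as Exp
import Algebra.Properties.Ring as RingProperties
import Algebra.Solver.Ring.NaturalCoefficients.Default as SemiringSolver
import Relation.Binary.Properties.StrictTotalOrder as TotalOrder
import Relation.Binary.Reasoning.StrictPartialOrder as OrderReasoning

-- The coefficients of the expanded polynomial vary with the sequence, so no monomial order can name
-- the dominant term in advance: the ratio of two coefficients may lie anywhere among the scales.
-- This is why monomials are compared pair by pair, keeping the scales on one side of that ratio.
-- The number of pairs is bounded by the formulas alone, so the total loss is a constant factor on
-- `n` inside both exponentials, and it disappears into `C`. A second obstacle is direction. Either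
-- centring may keep the elements below its centre, and these move away from it against the order of
-- the list. Lists are therefore arranged by growing scale, and the indices along them may increase
-- or decrease. Treating every polynomial together with its mirror image repairs the order at the
-- end. The additive and the multiplicative centring are instances of one lemma about an abstract
-- comparison of adjacent gaps.

module _ where
  open import Data.Nat using (_+_; _*_; _^_; _≤_; _<_)

  -- Sublists, pairwise relations and reversal.

  AllPairs-resp-⊆ : {A : Set} {R : Rel A 0ℓ} {xs ys : List A} → xs ⊆ ys → AllPairs R ys → AllPairs R xs
  AllPairs-resp-⊆ []         []       = []
  AllPairs-resp-⊆ (y ∷ʳ s)   (_ ∷ ps) = AllPairs-resp-⊆ s ps
  AllPairs-resp-⊆ (refl ∷ s) (p ∷ ps) = All-resp-⊆ s p ∷ AllPairs-resp-⊆ s ps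

  AllPairs-map-All : {A : Set} {P : A → Set} {R S : Rel A 0ℓ} → (∀ {x y} → P x → P y → R x y → S x y) →
                     ∀ {xs} → All P xs → AllPairs R xs → AllPairs S xs
  AllPairs-map-All h []       []       = []
  AllPairs-map-All h (p ∷ ps) (r ∷ rs) = All.zipWith (λ (q , s) → h p q s) (ps , r) ∷ AllPairs-map-All h ps rs

  AllPairs-++⁻ : {A : Set} {R : Rel A 0ℓ} (xs : List A) {ys : List A} → AllPairs R (xs ++ ys) →
                 AllPairs R xs × AllPairs R ys × All (λ x → All (R x) ys) xs
  AllPairs-++⁻ []       ps       = [] , ps , []
  AllPairs-++⁻ (x ∷ xs) (p ∷ ps) =
    let (a , b , c) = AllPairs-++⁻ xs ps in
    Allₚ.++⁻ˡ xs p ∷ a , b , Allₚ.++⁻ʳ xs p ∷ c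

  All-reverse : {A : Set} {P : A → Set} {xs : List A} → All P xs → All P (reverse xs)
  All-reverse {xs = xs} ps = All.tabulate (λ {y} → All.lookup ps {y} ∘ Anyₚ.reverse⁻ {xs = xs})

  AllPairs-reverse : {A : Set} {R : Rel A 0ℓ} {xs : List A} → AllPairs R xs → AllPairs (flip R) (reverse xs)
  AllPairs-reverse {xs = []}     []       = []
  AllPairs-reverse {R = R} {xs = x ∷ xs} (p ∷ ps) =
    subst (AllPairs (flip R)) (sym (Listₚ.unfold-reverse x xs))
      (AllPairsₚ.++⁺ (AllPairs-reverse ps) ([] ∷ []) (All.map (λ r → r ∷ []) (All-reverse p)))

  reverse-⊆ : {A : Set} {xs ys : List A} → xs ⊆ reverse ys → reverse xs ⊆ ys
  reverse-⊆ {xs = xs} {ys} s = subst (reverse xs ⊆_) (Listₚ.reverse-involutive ys) (reverse⁺ {as = xs} {bs = reverse ys} s)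

  tabulate-∷ʳ : {A : Set} {n : ℕ} (f : Fin (suc n) → A) → tabulate f ≡ tabulate (f ∘ inject₁) ++ [ f (Fin.fromℕ n) ]
  tabulate-∷ʳ {n = zero}  f = refl
  tabulate-∷ʳ {n = suc n} f = cong (f zero ∷_) (tabulate-∷ʳ (f ∘ suc))

  opposite-fromℕ : ∀ n → opposite (Fin.fromℕ n) ≡ zero
  opposite-fromℕ zero    = refl
  opposite-fromℕ (suc n) = cong inject₁ (opposite-fromℕ n)

  opposite-inject₁ : ∀ {n} (i : Fin n) → opposite (inject₁ i) ≡ suc (opposite i)
  opposite-inject₁ zero    = refl
  opposite-inject₁ (suc i) = cong inject₁ (opposite-inject₁ i)

  reverse-tabulate : {A : Set} {n : ℕ} (f : Fin n → A) → reverse (tabulate f) ≡ tabulate (f ∘ opposite)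
  reverse-tabulate {n = zero}  f = refl
  reverse-tabulate {n = suc n} f = begin
    reverse (f zero ∷ tabulate (f ∘ suc))              ≡⟨ Listₚ.unfold-reverse (f zero) (tabulate (f ∘ suc)) ⟩
    reverse (tabulate (f ∘ suc)) ++ [ f zero ]           ≡⟨ cong (_++ [ f zero ]) (reverse-tabulate (f ∘ suc)) ⟩
    tabulate (f ∘ suc ∘ opposite) ++ [ f zero ]
      ≡⟨ cong₂ (λ ys y → ys ++ [ y ]) (Listₚ.tabulate-cong (λ i → cong f (sym (opposite-inject₁ i))))
                                                                     (cong f (sym (opposite-fromℕ n))) ⟩
    tabulate (f ∘ opposite ∘ inject₁) ++ [ f (opposite (Fin.fromℕ n)) ] ≡⟨ tabulate-∷ʳ (f ∘ opposite) ⟨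
    tabulate (f ∘ opposite)                            ∎
    where open ≡-Reasoning

  Increasing : ∀ {m n} → (Fin m → Fin n) → Set
  Increasing ι = ∀ i j → i Fin.< j → ι i Fin.< ι j

  predecessors : ∀ {m n} (ι : Fin m → Fin (suc n)) → (∀ i → zero {n} Fin.< ι i) → Increasing ι →
                 ∃ λ (κ : Fin m → Fin n) → Increasing κ × (∀ i → ι i ≡ suc (κ i))
  predecessors ι pos inc = κ , (λ i j i<j → ℕ.s<s⁻¹ (subst₂ Fin._<_ (eq i) (eq j) (inc i j i<j))) , eq
    where
    κ = λ i → Fin.reduce≥ {1} (ι i) (pos i)
    eq : ∀ i → ι i ≡ suc (κ i)
    eq i with ι i | pos i
    ... | suc j | _ = refl

  -- Translates the increasing index tuples of the theorem into sublists, the form in which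
  -- statements about all tuples are made below.
  tabulate-lookup-⊆ : {A : Set} {k : ℕ} (l : List A) (ι : Fin k → Fin (length l)) → Increasing ι →
                      tabulate (lookup l ∘ ι) ⊆ l
  tabulate-lookup-⊆ {k = zero}  l        ι inc = minimum l
  tabulate-lookup-⊆ {k = suc k} []       ι inc with () ← ι zero
  tabulate-lookup-⊆ {k = suc k} (x ∷ xs) ι inc with ι zero in eq
  ... | suc i = helper
    where
    pos : ∀ j → zero {length xs} Fin.< ι j
    pos zero    rewrite eq = ℕ.z<s
    pos (suc j) = ℕₚ.≤-<-trans z≤n (inc zero (suc j) ℕ.z<s)
    helper : (lookup xs i ∷ tabulate (lookup (x ∷ xs) ∘ ι ∘ suc)) ⊆ (x ∷ xs)
    helper with predecessors ι pos inc
    ... | κ , κ-inc , e = subst (_⊆ (x ∷ xs))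
            (trans (Listₚ.tabulate-cong (λ j → sym (cong (lookup (x ∷ xs)) (e j))))
                   (cong (λ h → lookup (x ∷ xs) h ∷ tabulate (lookup (x ∷ xs) ∘ ι ∘ suc)) eq))
            (x ∷ʳ tabulate-lookup-⊆ xs κ κ-inc)
  ... | zero = refl ∷ helper
    where
    pos : ∀ j → zero {length xs} Fin.< ι (suc j)
    pos j = ℕₚ.≤-<-trans z≤n (inc zero (suc j) ℕ.z<s)
    helper : tabulate (lookup (x ∷ xs) ∘ ι ∘ suc) ⊆ xs
    helper with predecessors (ι ∘ suc) pos (λ i j i<j → inc (suc i) (suc j) (s≤s i<j))
    ... | κ , κ-inc , e = subst (_⊆ xs)
            (Listₚ.tabulate-cong (λ j → sym (cong (lookup (x ∷ xs)) (e j))))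
            (tabulate-lookup-⊆ xs κ κ-inc)

  lookup-AllPairs : {A : Set} {R : Rel A 0ℓ} {l : List A} → AllPairs R l →
                    ∀ i j → i Fin.< j → R (lookup l i) (lookup l j)
  lookup-AllPairs (p ∷ ps) zero    (suc j) _   = All.lookup p (∈-lookup j)
  lookup-AllPairs (p ∷ ps) (suc i) (suc j) i<j = lookup-AllPairs ps i j (ℕ.s<s⁻¹ i<j)

  -- Pigeonhole, and chains against antichains.

  split : {A : Set} {P : A → Set} → U.Decidable P → (l : List A) →
          ∃₂ λ c d → c ⊆ l × d ⊆ l × All P c × All (¬_ ∘ P) d × length c + length d ≡ length l
  split P? [] = [] , [] , [] , [] , [] , [] , refl
  split P? (x ∷ l) with split P? l | P? x
  ... | c , d , c⊆ , d⊆ , Pc , ¬Pd , eq | yes p = x ∷ c , d , refl ∷ c⊆ , x ∷ʳ d⊆ , p ∷ Pc , ¬Pd , cong suc eq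
  ... | c , d , c⊆ , d⊆ , Pc , ¬Pd , eq | no ¬p =
    c , x ∷ d , x ∷ʳ c⊆ , refl ∷ d⊆ , Pc , ¬p ∷ ¬Pd , trans (ℕₚ.+-suc (length c) (length d)) (cong suc eq)

  pigeonhole : {A : Set} (f : A → ℕ) (p q : ℕ) (l : List A) → All (λ x → f x < p) l → p * q < length l →
               ∃₂ λ r c → c ⊆ l × All (λ x → f x ≡ r) c × q < length c
  pigeonhole f zero q (x ∷ l) (() ∷ _) pq<
  pigeonhole f (suc p) q l f<p pq< with split (λ x → f x ℕ.≟ p) l
  ... | c , d , c⊆ , d⊆ , fc , fd , eq with q ℕ.<? length c
  ... | yes q< = p , c , c⊆ , fc , q<
  ... | no q≮ =
    let (r , c′ , c′⊆ , fc′ , q<) = pigeonhole f p q d f<d (ℕₚ.+-cancelˡ-< q _ _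
          (ℕₚ.<-≤-trans (subst (q + p * q <_) (sym eq) pq<) (ℕₚ.+-monoˡ-≤ (length d) (ℕₚ.≮⇒≥ q≮))))
    in r , c′ , ⊆-trans c′⊆ d⊆ , fc′ , q<
    where
    f<d = All.zipWith (λ (≢p , <1+p) → ℕₚ.≤∧≢⇒< (ℕ.s≤s⁻¹ <1+p) ≢p) (fd , All-resp-⊆ d⊆ f<p)

  -- Dilworth for transitive relations: an element is ranked by the longest
  -- chain starting at it, and elements of equal rank form an antichain.
  module _ {A : Set} {R : Rel A 0ℓ} (R? : Decidable R) (R-trans : Transitive R) where

    private
      ChainFrom : List A → A × ℕ → Set
      ChainFrom l (x , r) = ∃ λ c → (x ∷ c) ⊆ l × AllPairs R (x ∷ c) × length c ≡ r

      Ranked : Rel (A × ℕ) 0ℓ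
      Ranked (x , r) (y , s) = R x y → s < r

      longest : ∀ x l (rs : List (A × ℕ)) → All (ChainFrom l) rs →
                ∃ λ r → ChainFrom (x ∷ l) (x , r) × All (Ranked (x , r)) rs
      longest x l [] [] = 0 , ([] , refl ∷ minimum l , [] ∷ [] , refl) , []
      longest x l ((y , s) ∷ rs) ((c , y∷c⊆ , yc , len) ∷ chains) with longest x l rs chains
      ... | r , chain , below with R? x y | s ℕ.<? r
      ... | no ¬Rxy | _       = r , chain , (⊥-elim ∘ ¬Rxy) ∷ below
      ... | yes _   | yes s<r = r , chain , (λ _ → s<r) ∷ below
      ... | yes Rxy | no s≮r  =
        suc s , (y ∷ c , refl ∷ y∷c⊆ , xyc yc ∷ yc , cong suc len) ,
        (λ _ → ℕₚ.n<1+n s) ∷ All.map (λ lt R → ℕₚ.<-trans (lt R) (s≤s (ℕₚ.≮⇒≥ s≮r))) below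
        where
        xyc : AllPairs R (y ∷ c) → All (R x) (y ∷ c)
        xyc (p ∷ _) = Rxy ∷ All.map (R-trans Rxy) p

      rank : (l : List A) → ∃ λ rs → map proj₁ rs ≡ l × AllPairs Ranked rs × All (ChainFrom l) rs
      rank [] = [] , refl , [] , []
      rank (x ∷ l) with rank l
      ... | rs , eq , ranked , chains with longest x l rs chains
      ... | r , chain , below =
        (x , r) ∷ rs , cong (x ∷_) eq , below ∷ ranked ,
        chain ∷ All.map (λ (c , c⊆ , rest) → c , x ∷ʳ c⊆ , rest) chains

    chain-or-antichain : ∀ p q (l : List A) → p * q < length l →
      (∃ λ c → c ⊆ l × AllPairs R c × p < length c) ⊎
      (∃ λ c → c ⊆ l × AllPairs (λ x y → ¬ R x y) c × q < length c)
    chain-or-antichain p q l pq< with rank l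
    ... | rs , refl , ranked , chains with all? (λ (_ , r) → r ℕ.<? p) rs
    ... | no some≥p =
      let ((x , r) , ∈rs , r≮p) = find (Allₚ.¬All⇒Any¬ (λ (_ , r) → r ℕ.<? p) rs some≥p)
          (c , c⊆ , chain , len) = All.lookup chains ∈rs
      in inj₁ (x ∷ c , c⊆ , chain , s≤s (subst (p ≤_) (sym len) (ℕₚ.≮⇒≥ r≮p)))
    ... | yes all<p with pigeonhole proj₂ p q rs all<p (subst (p * q <_) (Listₚ.length-map proj₁ rs) pq<)
    ... | r , c , c⊆ , same , q< =
      inj₂ (map proj₁ c , map⁺ proj₁ c⊆ ,
            AllPairsₚ.map⁺ (AllPairs-map-All (λ { refl refl lt Rxy → ℕₚ.<-irrefl refl (lt Rxy) })
                                             same (AllPairs-resp-⊆ c⊆ ranked)) ,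
            subst (q <_) (sym (Listₚ.length-map proj₁ c)) q<)

  -- Growing distances by repeated halving.

  focus : {A : Set} (i : ℕ) (l : List A) → i < length l → ∃₂ λ ys m → ∃ λ zs → l ≡ ys ++ m ∷ zs × length ys ≡ i
  focus zero    (x ∷ l) _         = [] , x , l , refl , refl
  focus (suc i) (x ∷ l) (s≤s i<n) =
    let (ys , m , zs , eq , len) = focus i l i<n in x ∷ ys , m , zs , cong (x ∷_) eq , cong suc len

  n+n≤p+q⇒n≤p⊎n≤q : ∀ n p q → n + n ≤ p + q → n ≤ p ⊎ n ≤ q
  n+n≤p+q⇒n≤p⊎n≤q n p q h with n ℕ.≤? p | n ℕ.≤? q
  ... | yes n≤p | _       = inj₁ n≤p
  ... | no _    | yes n≤q = inj₂ n≤q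
  ... | no n≰p  | no n≰q  = ⊥-elim (ℕₚ.<⇒≱ (ℕₚ.+-mono-< (ℕₚ.≰⇒> n≰p) (ℕₚ.≰⇒> n≰q)) h)

  -- L x y z and U x y z are to be read as y - x ≤ z - y and z - y ≤ y - x.
  -- Halving the list at its middle element y and passing to the half whose
  -- ends are closer, the discarded end is recorded; all elements recorded on
  -- the same side at least double their distance to the final element t.
  module _ {A : Set} {_⊑_ : Rel A 0ℓ} {L U : A → A → A → Set}
    (⊑-reflˡ : ∀ {x y} → x ⊑ y → x ⊑ x) (⊑-reflʳ : ∀ {x y} → x ⊑ y → y ⊑ y)
    (L⊎U : ∀ x y z → L x y z ⊎ U x y z)
    (L-mono : ∀ {x y z t v} → y ⊑ z → L x y z → x ⊑ t → v ⊑ y → L t v z)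
    (U-mono : ∀ {x y z t u} → x ⊑ y → U x y z → y ⊑ u → t ⊑ z → U x u t)
    where

    private
      ends : ∀ {lo hi} ys → AllPairs _⊑_ (lo ∷ ys ++ [ hi ]) →
             All (λ x → lo ⊑ x × x ⊑ hi) (lo ∷ ys ++ [ hi ]) × lo ⊑ hi
      ends {lo} {hi} ys (p ∷ ps) with Allₚ.++⁻ʳ ys p | AllPairs-++⁻ (lo ∷ ys) (p ∷ ps)
      ... | lo⊑hi ∷ [] | _ , _ , q =
        All.zip ((⊑-reflˡ lo⊑hi ∷ p) ,
                 Allₚ.++⁺ {xs = lo ∷ ys} (All.map (λ { (r ∷ []) → r }) q) (⊑-reflʳ lo⊑hi ∷ [])) , lo⊑hi

      halvings : ∀ d lo xs hi → AllPairs _⊑_ (lo ∷ xs ++ [ hi ]) → 2 ^ d ≤ 1 + length xs →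
                 ∃₂ λ us t → ∃ λ vs → (us ++ t ∷ vs) ⊆ (lo ∷ xs ++ [ hi ]) ×
                   AllPairs (λ u u′ → U u u′ t) us × AllPairs (λ v v′ → L t v v′) vs × d ≤ length us + length vs
      halvings zero lo xs hi ord long = [] , lo , [] , refl ∷ minimum _ , [] , [] , z≤n
      halvings (suc d) lo xs hi ord long with 2 ^ d in eq
      ... | zero  = ⊥-elim (ℕₚ.<⇒≢ (ℕₚ.m^n>0 2 d) (sym eq))
      -- With `k` entries before `m`, the left part satisfies `2 ^ d ≤ 1 + length ys` with equality,
      -- and the right part inherits the rest of the bound.
      ... | suc k with focus k xs (ℕₚ.≤-trans (ℕₚ.m≤m+n (suc k) 0)
                                    (ℕₚ.≤-trans (ℕₚ.m≤n+m _ k) (ℕ.s≤s⁻¹ long)))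
      ... | ys , m , zs , refl , refl = main (L⊎U lo m hi)
        where
        assoc : (ys ++ m ∷ zs) ++ [ hi ] ≡ ys ++ m ∷ zs ++ [ hi ]
        assoc = Listₚ.++-assoc ys (m ∷ zs) [ hi ]
        whole = lo ∷ (ys ++ m ∷ zs) ++ [ hi ]
        left  = lo ∷ ys ++ [ m ]
        right = m ∷ zs ++ [ hi ]
        left-hi⊆ : (left ++ [ hi ]) ⊆ whole
        left-hi⊆ = refl ∷ subst₂ _⊆_ (sym (Listₚ.++-assoc ys [ m ] [ hi ])) (sym assoc)
                                 (++⁺ (⊆-refl {x = ys}) (refl ∷ ++⁺ˡ zs ⊆-refl))
        lo-right⊆ : (lo ∷ right) ⊆ whole
        lo-right⊆ = refl ∷ subst (right ⊆_) (sym assoc) (++⁺ˡ ys ⊆-refl)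
        left-ord : AllPairs _⊑_ left
        left-ord = AllPairs-resp-⊆ (⊆-trans (++⁺ʳ [ hi ] ⊆-refl) left-hi⊆) ord
        right-ord : AllPairs _⊑_ right
        right-ord = AllPairs-resp-⊆ (⊆-trans (lo ∷ʳ ⊆-refl) lo-right⊆) ord
        zs-long : suc k ≤ suc (length zs)
        zs-long = subst (_≤ suc (length zs)) (ℕₚ.+-identityʳ (suc k))
          (ℕₚ.+-cancelˡ-≤ (suc k) _ _ (subst (suc k + (suc k + 0) ≤_) (cong suc (Listₚ.length-++ ys)) long))
        main : L lo m hi ⊎ U lo m hi → _
        -- The lower half is the shorter, so `hi` is recorded. The final `t` and every `v` recorded
        -- in the recursion lie between `lo` and `m`, so in terms of distances
        -- `v - t ≤ m - lo ≤ hi - m ≤ hi - v`. The other case is symmetric.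
        main (inj₁ l) with halvings d lo ys m left-ord (ℕₚ.≤-reflexive eq)
        ... | us , t , vs , s , Us , Vs , len =
          us , t , vs ++ [ hi ] ,
          subst (_⊆ whole) (Listₚ.++-assoc us (t ∷ vs) [ hi ]) (⊆-trans (++⁺ s ⊆-refl) left-hi⊆) ,
          Us , AllPairsₚ.++⁺ Vs ([] ∷ []) (All.map (λ (_ , v⊑m) → L-mono m⊑hi l lo⊑t v⊑m ∷ []) (All.tail bounds)) ,
          ℕₚ.≤-trans (s≤s len) (ℕₚ.≤-reflexive more)
          where
          more : suc (length us + length vs) ≡ length us + length (vs ++ [ hi ])
          more = trans (sym (ℕₚ.+-suc (length us) (length vs)))
            (cong (length us +_) (sym (trans (Listₚ.length-++ vs) (ℕₚ.+-comm (length vs) 1))))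
          m⊑hi = ends zs right-ord .proj₂
          bounds = Allₚ.++⁻ʳ us (All-resp-⊆ s (ends ys left-ord .proj₁))
          lo⊑t = All.head bounds .proj₁
        main (inj₂ u) with halvings d m zs hi right-ord (subst (_≤ suc (length zs)) (sym eq) zs-long)
        ... | us , t , vs , s , Us , Vs , len =
          lo ∷ us , t , vs , ⊆-trans (refl ∷ s) lo-right⊆ ,
          All.map (λ (m⊑u , _) → U-mono lo⊑m u m⊑u t⊑hi) (Allₚ.++⁻ˡ us bounds) ∷ Us , Vs , s≤s len
          where
          lo⊑m = ends ys left-ord .proj₂
          bounds = All-resp-⊆ s (ends zs right-ord .proj₁)
          t⊑hi = All.head (Allₚ.++⁻ʳ us bounds) .proj₂

    -- Each of `m + m` halvings records one end, below or above `t`, so one side receives at least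
    -- `m` of them.
    doubling-distances : ∀ m l → AllPairs _⊑_ l → 2 ^ (m + m) < length l →
      ∃₂ λ us t → ∃ λ vs → (us ++ t ∷ vs) ⊆ l ×
        ((AllPairs (λ u u′ → U u u′ t) us × m ≤ length us) ⊎ (AllPairs (λ v v′ → L t v v′) vs × m ≤ length vs))
    doubling-distances m []       ord ()
    doubling-distances m (lo ∷ l) ord long with initLast l
    ... | [] = ⊥-elim (ℕₚ.<⇒≱ long (ℕₚ.m^n>0 2 (m + m)))
    ... | xs ∷ʳ′ hi with halvings (m + m) lo xs hi ord (ℕₚ.≤-trans (ℕ.s≤s⁻¹ long) (ℕₚ.≤-reflexive (trans (Listₚ.length-++ xs) (ℕₚ.+-comm (length xs) 1))))
    ... | us , t , vs , s , Us , Vs , len =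
      us , t , vs , s , Sum.map (Us ,_) (Vs ,_) (n+n≤p+q⇒n≤p⊎n≤q m (length us) (length vs) len)

  -- Thinning and successive refinement of lists.

  every-other : {A : Set} {R S : Rel A 0ℓ} → (∀ {x y z} → R x y → R y z → S x z) →
                ∀ m {l} → AllPairs R l → m + m ≤ length l → ∃ λ l′ → l′ ⊆ l × m ≤ length l′ × AllPairs S l′
  every-other ∘ᴿ zero    {l} rs _ = [] , minimum l , z≤n , []
  every-other ∘ᴿ (suc m) {x ∷ []} rs (s≤s h) with () ← subst (_≤ 0) (ℕₚ.+-suc m m) h
  every-other ∘ᴿ (suc m) {x ∷ y ∷ l} ((Rxy ∷ _) ∷ Ry ∷ rs) (s≤s h)
    with every-other ∘ᴿ m rs (ℕ.s≤s⁻¹ (subst (_≤ suc (length l)) (ℕₚ.+-suc m m) h))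
  ... | l′ , s , long , ss = x ∷ l′ , refl ∷ y ∷ʳ s , s≤s long , All.map (∘ᴿ Rxy) (All-resp-⊆ s Ry) ∷ ss

  -- Skipping every second element composes a relation with itself. After `j` rounds a gap is
  -- iterated `2 ^ j` times, while the length falls only by a factor that does not depend on `m`;
  -- this makes any prescribed gap affordable.
  thin : {A : Set} {R : ℕ → Rel A 0ℓ} → (∀ j {x y z} → R j x y → R j y z → R (suc j) x z) →
         ∀ j m {l} → AllPairs (R 0) l → 2 ^ j * m ≤ length l →
         ∃ λ l′ → l′ ⊆ l × m ≤ length l′ × AllPairs (R j) l′
  thin ∘ᴿ zero m {l} rs long = l , ⊆-refl , subst (_≤ length l) (ℕₚ.+-identityʳ m) long , rs
  thin {R = R} ∘ᴿ (suc j) m {l} rs long =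
    let (l₁ , s₁ , long₁ , rs₁) = thin {R = R} ∘ᴿ j (m + m) rs (ℕₚ.≤-trans (ℕₚ.≤-reflexive eq) long)
        (l₂ , s₂ , long₂ , rs₂) = every-other (∘ᴿ j) m rs₁ long₁
    in l₂ , ⊆-trans s₂ s₁ , long₂ , rs₂
    where
    eq : 2 ^ j * (m + m) ≡ 2 ^ suc j * m
    eq = trans (ℕₚ.*-distribˡ-+ (2 ^ j) m m)
      (trans (cong (λ n → 2 ^ j * m + n * m) (sym (ℕₚ.+-identityʳ (2 ^ j)))) (sym (ℕₚ.*-distribʳ-+ m (2 ^ j) _)))

  Hereditary : {A : Set} → (List A → Set) → Set
  Hereditary P = ∀ {l′ l} → l′ ⊆ l → P l → P l′

  -- Every sublist of `l₀` must admit the refinement, not only `l₀` itself, and the cost is a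
  -- factor: refinements can then be made one after another, their costs multiplying.
  Refinable : {A : Set} → List A → ℕ → (List A → Set) → Set
  Refinable l₀ c P = ∀ m {l} → l ⊆ l₀ → c * m ≤ length l → ∃ λ l′ → l′ ⊆ l × m ≤ length l′ × P l′

  -- Heredity preserves the properties already secured while later refinements shorten the list.
  refine-all : {A X : Set} {l₀ : List A} {P : X → List A → Set} {c : X → ℕ} → (∀ x → Hereditary (P x)) →
               ∀ {xs} → All (λ x → Refinable l₀ (c x) (P x)) xs →
               Refinable l₀ (product (map c xs)) (λ l → All (λ x → P x l) xs)
  refine-all her [] m {l} s long = l , ⊆-refl , subst (_≤ length l) (ℕₚ.+-identityʳ m) long , []
  refine-all {c = c} her {x ∷ xs} (r ∷ rs) m {l} s long =
    let (l₁ , s₁ , long₁ , p) = r (product (map c xs) * m) s (subst (_≤ length l) (ℕₚ.*-assoc (c x) _ m) long)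
        (l₂ , s₂ , long₂ , ps) = refine-all her rs m (⊆-trans s₁ s) long₁
    in l₂ , ⊆-trans s₂ s₁ , long₂ , her x s₂ p ∷ ps

  threshold : {A : Set} {P : A → Set} → U.Decidable P → ∀ {l} → AllPairs (λ x y → P x → P y) l →
              ∃₂ λ xs ys → l ≡ xs ++ ys × All (¬_ ∘ P) xs × All P ys
  threshold P? {[]}    []       = [] , [] , refl , [] , []
  threshold P? {x ∷ l} (f ∷ fs) with P? x
  ... | yes p = [] , x ∷ l , refl , [] , p ∷ All.map (λ g → g p) f
  ... | no ¬p = let (xs , ys , eq , ¬ps , ps) = threshold P? fs in x ∷ xs , ys , cong (x ∷_) eq , ¬p ∷ ¬ps , ps

  -- The immediate successor serves as the witness `y`, so only the last element, which has none, is
  -- lost.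
  drop-last : {A : Set} {P : A → Set} {R : Rel A 0ℓ} {l : List A} → All P l → AllPairs R l →
              ∃ λ l′ → l′ ⊆ l × length l ≤ suc (length l′) × All (λ x → ∃ λ y → P y × R x y) l′
  drop-last []            []              = [] , [] , z≤n , []
  drop-last (_ ∷ [])      (_ ∷ [])        = [] , minimum _ , s≤s z≤n , []
  drop-last (_ ∷ p ∷ ps) ((r ∷ _) ∷ rs) =
    let (l′ , s , long , h) = drop-last (p ∷ ps) rs in _ ∷ l′ , refl ∷ s , s≤s long , (_ , p , r) ∷ h

-- Lists are arranged by growing scale. Decreasing values and points below a centre must be reversed
-- for this, so the indices may run either way.
Oriented : {A : Set} → Rel A 0ℓ → List A → Set
Oriented R l = AllPairs R l ⊎ AllPairs (flip R) l

Oriented-⊆ : {A : Set} {R : Rel A 0ℓ} {l′ l : List A} → l′ ⊆ l → Oriented R l → Oriented R l′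
Oriented-⊆ s = Sum.map (AllPairs-resp-⊆ s) (AllPairs-resp-⊆ s)

Oriented-reverse : {A : Set} {R : Rel A 0ℓ} {l : List A} → Oriented R l → Oriented R (reverse l)
Oriented-reverse = Sum.swap ∘ Sum.map AllPairs-reverse AllPairs-reverse

n≤2^n : ∀ n → n ℕ.≤ 2 ℕ.^ n
n≤2^n zero    = z≤n
n≤2^n (suc n) = subst (λ p → suc n ℕ.≤ 2 ℕ.^ n ℕ.+ p) (sym (ℕₚ.+-identityʳ (2 ℕ.^ n))) (ℕₚ.+-mono-≤ (ℕₚ.m^n>0 2 n) (n≤2^n n))

-- Arithmetic of the ordered field.

module OrderedField (ℝ : RealField) where
  open RealField ℝ public
  open Semantics ℝ public

  ring : CommutativeRing 0ℓ 0ℓ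
  ring = record { isCommutativeRing = isCommutativeRing }

  strictTotalOrder : StrictTotalOrder 0ℓ 0ℓ 0ℓ
  strictTotalOrder = record { isStrictTotalOrder = isStrictTotalOrder }

  open CommutativeRing ring public
    using (+-assoc; +-comm; +-identityˡ; +-identityʳ; *-assoc; *-comm; *-identityˡ; *-identityʳ;
           zeroˡ; zeroʳ; distribˡ; distribʳ; -‿inverseˡ; -‿inverseʳ)
  open RingProperties (CommutativeRing.ring ring) public
    using (-‿distribˡ-*; -‿distribʳ-*; -‿involutive; -‿+-comm; -0#≈0#)
  open SemiringSolver (CommutativeRing.commutativeSemiring ring) public using (solve; _:+_; _:*_; _:=_; con)
  open Exp (CommutativeRing.commutativeSemiring ring) public using (_^_; ^-homo-*; ^-assocʳ; ^-distrib-*)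
  open StrictTotalOrder strictTotalOrder public
    using (compare) renaming (irrefl to <-irrefl; trans to <-trans)
  open TotalOrder strictTotalOrder public
    using (_≤?_) renaming (refl to ≤-refl; trans to ≤-trans; reflexive to ≤-reflexive; total to ≤-total)
  open OrderReasoning (StrictTotalOrder.strictPartialOrder strictTotalOrder) public

  <⇒≤ : ∀ {x y} → x < y → x ≤ y
  <⇒≤ = inj₁

  <-≤-trans : ∀ {x y z} → x < y → y ≤ z → x < z
  <-≤-trans x<y (inj₁ y<z)  = <-trans x<y y<z
  <-≤-trans x<y (inj₂ refl) = x<y

  <⇒≱ : ∀ {x y} → x < y → ¬ (y ≤ x)
  <⇒≱ x<y y≤x = <-irrefl refl (<-≤-trans x<y y≤x)

  ≰⇒≥ : ∀ {x y} → ¬ (x ≤ y) → y ≤ x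
  ≰⇒≥ {x} {y} x≰y with ≤-total x y
  ... | inj₁ x≤y = ⊥-elim (x≰y x≤y)
  ... | inj₂ y≤x = y≤x

  +-monoˡ-≤ : ∀ z {x y} → x ≤ y → x + z ≤ y + z
  +-monoˡ-≤ z (inj₁ x<y)  = inj₁ (+-mono-< _ _ z x<y)
  +-monoˡ-≤ z (inj₂ refl) = inj₂ refl

  +-monoʳ-≤ : ∀ z {x y} → x ≤ y → z + x ≤ z + y
  +-monoʳ-≤ z {x} {y} x≤y = subst₂ _≤_ (+-comm x z) (+-comm y z) (+-monoˡ-≤ z x≤y)

  +-mono-≤ : ∀ {x y u v} → x ≤ y → u ≤ v → x + u ≤ y + v
  +-mono-≤ {y = y} {u} x≤y u≤v = ≤-trans (+-monoˡ-≤ u x≤y) (+-monoʳ-≤ y u≤v)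

  x<y⇒0<y-x : ∀ {x y} → x < y → 0r < y + - x
  x<y⇒0<y-x {x} {y} x<y = subst (_< y + - x) (-‿inverseʳ x) (+-mono-< x y (- x) x<y)

  x-y+y≡x : ∀ x y → (x + - y) + y ≡ x
  x-y+y≡x x y = trans (+-assoc x (- y) y) (trans (cong (x +_) (-‿inverseˡ y)) (+-identityʳ x))

  *-monoˡ-< : ∀ {z} → 0r < z → ∀ {x y} → x < y → z * x < z * y
  *-monoˡ-< {z} 0<z {x} {y} x<y = begin-strict
    z * x                        ≡⟨ +-identityˡ (z * x) ⟨
    0r + z * x                   <⟨ +-mono-< _ _ (z * x) (*-pos z _ 0<z (x<y⇒0<y-x x<y)) ⟩
    z * (y + - x) + z * x        ≡⟨ distribˡ z (y + - x) x ⟨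
    z * ((y + - x) + x)          ≡⟨ cong (z *_) (x-y+y≡x y x) ⟩
    z * y                        ∎

  *-monoˡ-≤ : ∀ {z} → 0r ≤ z → ∀ {x y} → x ≤ y → z * x ≤ z * y
  *-monoˡ-≤ (inj₁ 0<z)          (inj₁ x<y)  = inj₁ (*-monoˡ-< 0<z x<y)
  *-monoˡ-≤ (inj₂ refl) {x} {y} (inj₁ x<y)  = inj₂ (trans (zeroˡ x) (sym (zeroˡ y)))
  *-monoˡ-≤ _                   (inj₂ refl) = inj₂ refl

  *-monoʳ-≤ : ∀ {z} → 0r ≤ z → ∀ {x y} → x ≤ y → x * z ≤ y * z
  *-monoʳ-≤ {z} 0≤z {x} {y} x≤y = subst₂ _≤_ (*-comm z x) (*-comm z y) (*-monoˡ-≤ 0≤z x≤y)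

  *-mono-≤ : ∀ {x y u v} → 0r ≤ x → 0r ≤ v → x ≤ y → u ≤ v → x * u ≤ y * v
  *-mono-≤ 0≤x 0≤v x≤y u≤v = ≤-trans (*-monoˡ-≤ 0≤x u≤v) (*-monoʳ-≤ 0≤v x≤y)

  *-cancelˡ-≤ : ∀ {z} → 0r < z → ∀ {x y} → z * x ≤ z * y → x ≤ y
  *-cancelˡ-≤ 0<z {x} {y} zx≤zy with compare x y
  ... | tri< x<y _ _ = inj₁ x<y
  ... | tri≈ _ x≡y _ = inj₂ x≡y
  ... | tri> _ _ y<x = ⊥-elim (<⇒≱ (*-monoˡ-< 0<z y<x) zx≤zy)

  *-cancelˡ-< : ∀ {z} → 0r < z → ∀ {x y} → z * x < z * y → x < y
  *-cancelˡ-< 0<z {x} {y} zx<zy with compare x y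
  ... | tri< x<y _ _  = x<y
  ... | tri≈ _ refl _ = ⊥-elim (<-irrefl refl zx<zy)
  ... | tri> _ _ y<x  = ⊥-elim (<⇒≱ zx<zy (<⇒≤ (*-monoˡ-< 0<z y<x)))

  *-cancelʳ-≤ : ∀ {z} → 0r < z → ∀ {x y} → x * z ≤ y * z → x ≤ y
  *-cancelʳ-≤ {z} 0<z {x} {y} xz≤yz = *-cancelˡ-≤ 0<z (subst₂ _≤_ (*-comm x z) (*-comm y z) xz≤yz)

  0≤* : ∀ {x y} → 0r ≤ x → 0r ≤ y → 0r ≤ x * y
  0≤* {x} {y} 0≤x 0≤y = subst (_≤ x * y) (zeroʳ x) (*-monoˡ-≤ 0≤x 0≤y)

  x<0⇒0<-x : ∀ {x} → x < 0r → 0r < - x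
  x<0⇒0<-x {x} x<0 = subst (0r <_) (+-identityˡ (- x)) (x<y⇒0<y-x x<0)

  0<1 : 0r < 1r
  0<1 with compare 0r 1r
  ... | tri< 0<1 _ _ = 0<1
  ... | tri≈ _ 0≡1 _ = ⊥-elim (0≢1 0≡1)
  ... | tri> _ _ 1<0 = subst (0r <_) eq (*-pos _ _ 0<-1 0<-1)
    where
    0<-1 = x<0⇒0<-x 1<0
    eq : - 1r * - 1r ≡ 1r
    eq = trans (sym (-‿distribʳ-* (- 1r) 1r)) (trans (cong -_ (*-identityʳ (- 1r))) (-‿involutive 1r))

  0≤1 : 0r ≤ 1r
  0≤1 = <⇒≤ 0<1

  ⁻¹-pos : ∀ {x} → 0r < x → 0r < x ⁻¹
  ⁻¹-pos {x} 0<x with compare 0r (x ⁻¹)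
  ... | tri< 0<x⁻¹ _ _ = 0<x⁻¹
  ... | tri≈ _ 0≡x⁻¹ _ = ⊥-elim (0≢1 (trans (sym (zeroʳ x)) (trans (cong (x *_) 0≡x⁻¹) (⁻¹-inverse x (λ { refl → <-irrefl refl 0<x })))))
  ... | tri> _ _ x⁻¹<0 = ⊥-elim (<-irrefl refl (<-trans 0<1 (subst₂ _<_ (⁻¹-inverse x (λ { refl → <-irrefl refl 0<x })) (zeroʳ x) (*-monoˡ-< 0<x x⁻¹<0))))

  1≤⇒0< : ∀ {x} → 1r ≤ x → 0r < x
  1≤⇒0< = <-≤-trans 0<1

  1≤⇒0≤ : ∀ {x} → 1r ≤ x → 0r ≤ x
  1≤⇒0≤ = <⇒≤ ∘ 1≤⇒0<

  1≤* : ∀ {x y} → 1r ≤ x → 1r ≤ y → 1r ≤ x * y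
  1≤* {x} {y} 1≤x 1≤y = subst (_≤ x * y) (*-identityˡ 1r) (*-mono-≤ 0≤1 (1≤⇒0≤ 1≤y) 1≤x 1≤y)

  1≤^ : ∀ {x} n → 1r ≤ x → 1r ≤ x ^ n
  1≤^ zero    1≤x = ≤-refl
  1≤^ (suc n) 1≤x = 1≤* 1≤x (1≤^ n 1≤x)

  0<^ : ∀ {x} n → 0r < x → 0r < x ^ n
  0<^ zero    0<x = 0<1
  0<^ (suc n) 0<x = *-pos _ _ 0<x (0<^ n 0<x)

  ^-monoʳ-≤ : ∀ {x m n} → 1r ≤ x → m ℕ.≤ n → x ^ m ≤ x ^ n
  ^-monoʳ-≤ {n = n} 1≤x z≤n       = 1≤^ n 1≤x
  ^-monoʳ-≤         1≤x (s≤s m≤n) = *-monoˡ-≤ (1≤⇒0≤ 1≤x) (^-monoʳ-≤ 1≤x m≤n)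

  ^-monoˡ-≤ : ∀ {x y} n → 0r < x → x ≤ y → x ^ n ≤ y ^ n
  ^-monoˡ-≤ zero    0<x x≤y = ≤-refl
  ^-monoˡ-≤ (suc n) 0<x x≤y = *-mono-≤ (<⇒≤ 0<x) (<⇒≤ (0<^ n (<-≤-trans 0<x x≤y))) x≤y (^-monoˡ-≤ n 0<x x≤y)

  x≤1*x : ∀ {x y} → 1r ≤ y → 0r ≤ x → x ≤ y * x
  x≤1*x {x} {y} 1≤y 0≤x = subst (_≤ y * x) (*-identityˡ x) (*-monoʳ-≤ 0≤x 1≤y)

  2r : Carrier
  2r = 1r + 1r

  x+x≡2*x : ∀ x → x + x ≡ 2r * x
  x+x≡2*x = solve 1 (λ x → x :+ x := (con 1 :+ con 1) :* x) refl

  1≤2 : 1r ≤ 2r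
  1≤2 = subst (_≤ 2r) (+-identityʳ 1r) (+-monoʳ-≤ 1r 0≤1)

  fromℕ≤2^ : ∀ n → fromℕ n ≤ 2r ^ n
  fromℕ≤2^ zero    = 0≤1
  fromℕ≤2^ (suc n) = subst (1r + fromℕ n ≤_) (x+x≡2*x (2r ^ n)) (+-mono-≤ (1≤^ n 1≤2) (fromℕ≤2^ n))

  -- Monomials and the order of their exponent vectors.

  monomial : ∀ {k} → Vec ℕ k → (Fin k → Carrier) → Carrier
  monomial []      x = 1r
  monomial (a ∷ α) x = x zero ^ a * monomial α (x ∘ suc)

  monomial-pos : ∀ {k} (α : Vec ℕ k) {x} → (∀ i → 0r < x i) → 0r < monomial α x
  monomial-pos []      pos = 0<1
  monomial-pos (a ∷ α) pos = *-pos _ _ (0<^ a (pos zero)) (monomial-pos α (pos ∘ suc))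

  1≤monomial : ∀ {k} (α : Vec ℕ k) {x} → (∀ i → 1r ≤ x i) → 1r ≤ monomial α x
  1≤monomial []      pos = ≤-refl
  1≤monomial (a ∷ α) pos = 1≤* (1≤^ a (pos zero)) (1≤monomial α (pos ∘ suc))

  monomial-scale : ∀ {k} (α : Vec ℕ k) {τ x y} → (∀ i → x i ≡ τ * y i) →
                   monomial α x ≡ τ ^ Vec.sum α * monomial α y
  monomial-scale []      eq = sym (*-identityˡ 1r)
  monomial-scale (a ∷ α) {τ} {x} {y} eq = begin-equality
    x zero ^ a * monomial α (x ∘ suc)
      ≡⟨ cong₂ (λ z w → z ^ a * w) (eq zero) (monomial-scale α (eq ∘ suc)) ⟩
    (τ * y zero) ^ a * (τ ^ Vec.sum α * monomial α (y ∘ suc))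
      ≡⟨ cong (_* (τ ^ Vec.sum α * monomial α (y ∘ suc))) (^-distrib-* τ (y zero) a) ⟩
    (τ ^ a * y zero ^ a) * (τ ^ Vec.sum α * monomial α (y ∘ suc))
      ≡⟨ solve 4 (λ s t u v → (s :* t) :* (u :* v) := (s :* u) :* (t :* v)) refl (τ ^ a) (y zero ^ a) (τ ^ Vec.sum α) _ ⟩
    (τ ^ a * τ ^ Vec.sum α) * (y zero ^ a * monomial α (y ∘ suc))
      ≡⟨ cong (_* (y zero ^ a * monomial α (y ∘ suc))) (^-homo-* τ a (Vec.sum α)) ⟨
    τ ^ (a ℕ.+ Vec.sum α) * (y zero ^ a * monomial α (y ∘ suc))     ∎

  monomial-* : ∀ {k} (α : Vec ℕ k) (x y : Fin k → Carrier) →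
               monomial α x * monomial α y ≡ monomial α (λ i → x i * y i)
  monomial-* []      x y = *-identityˡ 1r
  monomial-* (a ∷ α) x y = begin-equality
    (x zero ^ a * monomial α (x ∘ suc)) * (y zero ^ a * monomial α (y ∘ suc))
      ≡⟨ solve 4 (λ s t u v → (s :* t) :* (u :* v) := (s :* u) :* (t :* v)) refl (x zero ^ a) _ (y zero ^ a) _ ⟩
    (x zero ^ a * y zero ^ a) * (monomial α (x ∘ suc) * monomial α (y ∘ suc))
      ≡⟨ cong₂ _*_ (sym (^-distrib-* (x zero) (y zero) a)) (monomial-* α (x ∘ suc) (y ∘ suc)) ⟩
    (x zero * y zero) ^ a * monomial α (λ i → x (suc i) * y (suc i))           ∎

  monomial-+ : ∀ {k} (α β : Vec ℕ k) (x : Fin k → Carrier) →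
               monomial (Vec.zipWith ℕ._+_ α β) x ≡ monomial α x * monomial β x
  monomial-+ []      []      x = sym (*-identityˡ 1r)
  monomial-+ (a ∷ α) (b ∷ β) x = begin-equality
    x zero ^ (a ℕ.+ b) * monomial (Vec.zipWith ℕ._+_ α β) (x ∘ suc)
      ≡⟨ cong₂ _*_ (^-homo-* (x zero) a b) (monomial-+ α β (x ∘ suc)) ⟩
    (x zero ^ a * x zero ^ b) * (monomial α (x ∘ suc) * monomial β (x ∘ suc))
      ≡⟨ solve 4 (λ s t u v → (s :* t) :* (u :* v) := (s :* u) :* (t :* v)) refl (x zero ^ a) (x zero ^ b) _ _ ⟩
    (x zero ^ a * monomial α (x ∘ suc)) * (x zero ^ b * monomial β (x ∘ suc)) ∎

  infix 4 _≺_
  -- The colexicographic order: the last differing exponent decides. Since scales grow along a list,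
  -- it belongs to the largest scale on which the two monomials disagree.
  data _≺_ : ∀ {k} → Vec ℕ k → Vec ℕ k → Set where
    here  : ∀ {k a b} {γ : Vec ℕ k} → a ℕ.< b → (a ∷ γ) ≺ (b ∷ γ)
    there : ∀ {k a b} {α β : Vec ℕ k} → α ≺ β → (a ∷ α) ≺ (b ∷ β)

  ≢⇒≺⊎≻ : ∀ {k} (α β : Vec ℕ k) → α ≢ β → α ≺ β ⊎ β ≺ α
  ≢⇒≺⊎≻ []      []      α≢β = ⊥-elim (α≢β refl)
  ≢⇒≺⊎≻ (a ∷ α) (b ∷ β) α≢β with Vecₚ.≡-dec ℕ._≟_ α β
  ... | no tails = Sum.map there there (≢⇒≺⊎≻ α β tails)
  ... | yes refl with ℕₚ.<-cmp a b
  ... | tri< a<b _ _ = inj₁ (here a<b)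
  ... | tri≈ _ refl _ = ⊥-elim (α≢β refl)
  ... | tri> _ _ b<a = inj₂ (here b<a)

-- Separation of two monomials on steeply growing scales.

module Separation (ℝ : RealField) where
  open OrderedField ℝ

  module _ {A : Set} (M : Carrier) (E : ℕ) (1≤M : 1r ≤ M) where

    private
      0<M = 1≤⇒0< 1≤M
      0≤M = 1≤⇒0≤ 1≤M

    Dominated : ∀ {k} → (A → Carrier) → List A → Carrier → Vec ℕ k → Carrier → Vec ℕ k → Set
    Dominated {k} v l c α d β = ∀ (e : Fin k → A) → tabulate e ⊆ l →
      M * (c * monomial α (v ∘ e)) ≤ d * monomial β (v ∘ e)

    Comparable : ∀ {k} → (A → Carrier) → Carrier → Vec ℕ k → Carrier → Vec ℕ k → List A → Set
    Comparable v c α d β l = Dominated v l c α d β ⊎ Dominated v l d β c α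

    Comparable-hereditary : ∀ {k} v c (α : Vec ℕ k) d β → Hereditary (Comparable v c α d β)
    Comparable-hereditary v c α d β s = Sum.map (λ h e t → h e (⊆-trans t s)) (λ h e t → h e (⊆-trans t s))

    -- The coefficients are quantified after the list: one list serves all of them, each pair
    -- costing a further factor of two when it becomes known. Rescaling by constants is thereby
    -- free.
    Separated : (A → Carrier) → List A → Set
    Separated v l = ∀ {k} (α β : Vec ℕ k) → α ≢ β → Vec.sum α ℕ.≤ E → Vec.sum β ℕ.≤ E →
      ∀ {c d} → 0r ≤ c → 0r ≤ d → Refinable l 2 (Comparable v c α d β)

    Steep : (A → Carrier) → Rel A 0ℓ
    Steep v x y = v x ^ (2 ℕ.+ E) ≤ v y

    -- Variables before the deciding one are absorbed into the coefficient `c`, the steep growth of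
    -- the next scale paying for the power `x ^ a`. At the deciding variable the surplus power of
    -- the scale pays for `M` and the ratio of the coefficients.
    dominated-above : ∀ v {k} {α β : Vec ℕ k} → α ≺ β → Vec.sum α ℕ.≤ E → ∀ {c d} → 0r ≤ c → 0r ≤ d →
      ∀ e → AllPairs (Steep v) (tabulate e) → All (λ x → 1r ≤ v x) (tabulate e) →
      All (λ x → M * c ≤ d * v x) (tabulate e) →
      M * (c * monomial α (v ∘ e)) ≤ d * monomial β (v ∘ e)
    dominated-above v (here {a = a} {b} {γ} a<b) ≤E {c} {d} 0≤c 0≤d e _ (1≤x ∷ 1≤xs) (Mc≤dx ∷ _) = begin
      M * (c * (x ^ a * z))
        ≡⟨ solve 4 (λ m c p z → m :* (c :* (p :* z)) := (m :* c) :* (p :* z)) refl M c (x ^ a) z ⟩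
      (M * c) * (x ^ a * z)    ≤⟨ *-monoʳ-≤ (0≤* (<⇒≤ (0<^ a (1≤⇒0< 1≤x))) 0≤z) Mc≤dx ⟩
      (d * x) * (x ^ a * z)
        ≡⟨ solve 4 (λ d x p z → (d :* x) :* (p :* z) := d :* (x :* p :* z)) refl d x (x ^ a) z ⟩
      d * (x ^ suc a * z)      ≤⟨ *-monoˡ-≤ 0≤d (*-monoʳ-≤ 0≤z (^-monoʳ-≤ 1≤x a<b)) ⟩
      d * (x ^ b * z)          ∎
      where
      x = v (e zero)
      z = monomial γ (v ∘ e ∘ suc)
      0≤z = 1≤⇒0≤ (1≤monomial γ (Allₚ.tabulate⁻ 1≤xs))
    dominated-above v (there {a = a} {b} {α} {β} α≺β) ≤E {c} {d} 0≤c 0≤d e (x≪ ∷ ≪) (1≤x ∷ 1≤xs) (Mc≤dx ∷ _) = begin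
      M * (c * (x ^ a * monomial α y))    ≡⟨ cong (M *_) (*-assoc c (x ^ a) _) ⟨
      M * ((c * x ^ a) * monomial α y)    ≤⟨ dominated-above v α≺β (ℕₚ.≤-trans (ℕₚ.m≤n+m _ a) ≤E)
                                              (0≤* 0≤c (<⇒≤ (0<^ a (1≤⇒0< 1≤x)))) 0≤d (e ∘ suc) ≪ 1≤xs (All.map step x≪) ⟩
      d * monomial β y
        ≤⟨ *-monoˡ-≤ 0≤d (x≤1*x (1≤^ b 1≤x) (1≤⇒0≤ (1≤monomial β (Allₚ.tabulate⁻ 1≤xs)))) ⟩
      d * (x ^ b * monomial β y)          ∎
      where
      x = v (e zero)
      y = v ∘ e ∘ suc
      step : ∀ {w} → Steep v (e zero) w → M * (c * x ^ a) ≤ d * v w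
      step {w} x≪w = begin
        M * (c * x ^ a)   ≡⟨ *-assoc M c _ ⟨
        (M * c) * x ^ a   ≤⟨ *-monoʳ-≤ (<⇒≤ (0<^ a (1≤⇒0< 1≤x))) Mc≤dx ⟩
        (d * x) * x ^ a   ≡⟨ *-assoc d x _ ⟩
        d * x ^ suc a
          ≤⟨ *-monoˡ-≤ 0≤d (^-monoʳ-≤ 1≤x (s≤s (ℕₚ.≤-trans (ℕₚ.m≤m+n a _) (ℕₚ.≤-trans ≤E (ℕₚ.n≤1+n E))))) ⟩
        d * x ^ (2 ℕ.+ E) ≤⟨ *-monoˡ-≤ 0≤d x≪w ⟩
        d * v w           ∎

    -- A monomial of degree at most `n` is bounded by the `n`-th power of its largest scale. The
    -- induction moves `x ^ b` into `c` and lowers `n` by `b`. There is at least one variable,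
    -- because the bound on `c` is read off an entry of the tuple.
    dominated-below : ∀ (v : A → Carrier) {k} (β : Vec ℕ (suc k)) n → Vec.sum β ℕ.≤ n → ∀ {c d} → 0r ≤ c →
      ∀ e → AllPairs (λ x y → v x ≤ v y) (tabulate e) → All (λ x → 1r ≤ v x) (tabulate e) →
      All (λ x → c * v x ^ n ≤ d) (tabulate e) → c * monomial β (v ∘ e) ≤ d
    dominated-below v (b ∷ []) n ≤n {c} {d} 0≤c e _ (1≤x ∷ _) (cx≤d ∷ _) = begin
      c * (x ^ b * 1r)  ≡⟨ cong (c *_) (*-identityʳ (x ^ b)) ⟩
      c * x ^ b         ≤⟨ *-monoˡ-≤ 0≤c (^-monoʳ-≤ 1≤x (ℕₚ.m+n≤o⇒m≤o b ≤n)) ⟩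
      c * x ^ n         ≤⟨ cx≤d ⟩
      d                 ∎
      where x = v (e zero)
    dominated-below v (b ∷ β@(_ ∷ _)) n ≤n {c} {d} 0≤c e (x≤ ∷ ord) (1≤x ∷ 1≤xs) (_ ∷ cxs≤d) = begin
      c * (x ^ b * monomial β y)   ≡⟨ *-assoc c (x ^ b) _ ⟨
      (c * x ^ b) * monomial β y
        ≤⟨ dominated-below v β (n ℕ.∸ b) (ℕₚ.m+n≤o⇒m≤o∸n _ (subst (ℕ._≤ n) (ℕₚ.+-comm b _) ≤n)) (0≤* 0≤c (<⇒≤ (0<^ b 0<x)))
                                        (e ∘ suc) ord 1≤xs (All.zipWith step (x≤ , cxs≤d)) ⟩
      d                            ∎
      where
      x = v (e zero)
      y = v ∘ e ∘ suc
      0<x = 1≤⇒0< 1≤x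
      step : ∀ {w} → x ≤ v w × c * v w ^ n ≤ d → (c * x ^ b) * v w ^ (n ℕ.∸ b) ≤ d
      step {w} (x≤w , cw≤d) = begin
        (c * x ^ b) * v w ^ (n ℕ.∸ b)
          ≤⟨ *-monoʳ-≤ (<⇒≤ (0<^ (n ℕ.∸ b) (<-≤-trans 0<x x≤w))) (*-monoˡ-≤ 0≤c (^-monoˡ-≤ b 0<x x≤w)) ⟩
        (c * v w ^ b) * v w ^ (n ℕ.∸ b)  ≡⟨ *-assoc c _ _ ⟩
        c * (v w ^ b * v w ^ (n ℕ.∸ b))  ≡⟨ cong (c *_) (^-homo-* (v w) b (n ℕ.∸ b)) ⟨
        c * v w ^ (b ℕ.+ (n ℕ.∸ b))      ≡⟨ cong (λ m → c * v w ^ m) (ℕₚ.m+[n∸m]≡n (ℕₚ.m+n≤o⇒m≤o b ≤n)) ⟩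
        c * v w ^ n                      ≤⟨ cw≤d ⟩
        d                                ∎

    steep⇒≤ : ∀ v {x y} → 1r ≤ v x → Steep v x y → v x ≤ v y
    steep⇒≤ v {x} {y} 1≤x x≪y = ≤-trans (subst (_≤ v x ^ (2 ℕ.+ E)) (*-identityʳ (v x)) (^-monoʳ-≤ {m = 1} {2 ℕ.+ E} 1≤x (s≤s z≤n))) x≪y

    -- The ratio of the two coefficients is compared with the scale v. It is
    -- irrelevant at all sufficiently large scales and decisive at all
    -- sufficiently small ones; at most two scales are neither.
    steep-≺ : ∀ v {l} → AllPairs (Steep v) l → All (λ x → M ≤ v x) l →
      ∀ {k} {α β : Vec ℕ k} → α ≺ β → Vec.sum α ℕ.≤ E → Vec.sum β ℕ.≤ E →
      ∀ {c d} → 0r ≤ c → 0r ≤ d → Refinable l 2 (Comparable v c α d β)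
    steep-≺ v steep big {α = α} {β} α≺β α≤E β≤E {c} {d} 0≤c 0≤d m {l} s long
      with threshold (λ x → M * c ≤? d * v x) (AllPairs-map-All (λ M≤x M≤y x≪y Mc≤dx →
                 ≤-trans Mc≤dx (*-monoˡ-≤ 0≤d (steep⇒≤ v (≤-trans 1≤M M≤x) x≪y)))
               (All-resp-⊆ s big) (AllPairs-resp-⊆ s steep))
    ... | xs , ys , refl , small , large with m ℕ.≤? length ys
    ... | yes m≤ys = ys , ++⁺ˡ xs ⊆-refl , m≤ys , inj₁ λ e t →
      let t′ = ⊆-trans t (⊆-trans (++⁺ˡ xs ⊆-refl) s) in
      dominated-above v α≺β α≤E 0≤c 0≤d e (AllPairs-resp-⊆ t′ steep)
        (All.map (≤-trans 1≤M) (All-resp-⊆ t′ big)) (All-resp-⊆ t large)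
    ... | no m≰ys
      with drop-last (All.zip (small , All-resp-⊆ xs⊆ big)) (AllPairs-map-All (λ M≤x _ x≪y → M≤x , x≪y) (All-resp-⊆ xs⊆ big) (AllPairs-resp-⊆ xs⊆ steep))
      where xs⊆ = ⊆-trans (++⁺ʳ ys ⊆-refl) s
    ... | xs′ , s′ , long′ , small′ = xs′ , ⊆-trans s′ (++⁺ʳ ys ⊆-refl) , m≤xs′ , inj₂ (main β α≺β β≤E)
      where
      -- The lost element is affordable: otherwise `xs` has at most `m` entries and `ys` fewer than
      -- `m`, too few for `2 * m`.
      m≤xs′ : m ℕ.≤ length xs′
      m≤xs′ = ℕₚ.≮⇒≥ λ xs′<m → ℕₚ.<⇒≱ (ℕₚ.+-mono-≤-< (ℕₚ.≤-trans long′ xs′<m) (ℕₚ.≰⇒> m≰ys))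
        (subst₂ ℕ._≤_ (cong (m ℕ.+_) (ℕₚ.+-identityʳ m)) (Listₚ.length-++ xs) long)
      -- The test fails even at the successor `y`, which exceeds `v x ^ (2 + E)`. Of these powers
      -- `E` cover the degree of `β`, one covers the factor of domination, and one the `M` in the
      -- failed test.
      step : ∀ {x} → (∃ λ y → (¬ (M * c ≤ d * v y) × M ≤ v y) × M ≤ v x × Steep v x y) → (M * d) * v x ^ E ≤ c
      step {x} (y , (Mc≰dy , _) , M≤x , x≪y) = *-cancelˡ-≤ 0<M (begin
        M * ((M * d) * v x ^ E)
          ≡⟨ solve 3 (λ m d p → m :* ((m :* d) :* p) := (m :* m) :* (d :* p)) refl M d _ ⟩
        (M * M) * (d * v x ^ E)      ≤⟨ *-monoʳ-≤ (0≤* 0≤d (<⇒≤ (0<^ E 0<x))) (*-mono-≤ 0≤M (<⇒≤ 0<x) M≤x M≤x) ⟩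
        (v x * v x) * (d * v x ^ E)
          ≡⟨ solve 3 (λ x d p → (x :* x) :* (d :* p) := d :* (x :* (x :* p))) refl (v x) d _ ⟩
        d * v x ^ (2 ℕ.+ E)          ≤⟨ *-monoˡ-≤ 0≤d x≪y ⟩
        d * v y                      ≤⟨ ≰⇒≥ Mc≰dy ⟩
        M * c                        ∎)
        where 0<x = <-≤-trans 0<M M≤x
      main : ∀ {k} {α : Vec ℕ k} (β : Vec ℕ k) → α ≺ β → Vec.sum β ℕ.≤ E → Dominated v xs′ d β c α
      main {α = α} β@(_ ∷ _) _ β≤E e t = begin
        M * (d * monomial β (v ∘ e))   ≡⟨ *-assoc M d _ ⟨
        (M * d) * monomial β (v ∘ e)   ≤⟨ dominated-below v β E β≤E (0≤* 0≤M 0≤d) e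
                                            (AllPairs-map-All (λ 1≤x _ → steep⇒≤ v 1≤x) 1≤e (AllPairs-resp-⊆ t′ steep))
                                            1≤e (All.map step (All-resp-⊆ t small′)) ⟩
        c                              ≤⟨ x≤1*x (1≤monomial α (Allₚ.tabulate⁻ 1≤e)) 0≤c ⟩
        monomial α (v ∘ e) * c         ≡⟨ *-comm _ c ⟩
        c * monomial α (v ∘ e)         ∎
        where
        xs′⊆ = ⊆-trans (⊆-trans s′ (++⁺ʳ ys ⊆-refl)) s
        t′ = ⊆-trans t xs′⊆
        1≤e = All.map (≤-trans 1≤M) (All-resp-⊆ t′ big)

    steep⇒separated : ∀ v {l} → AllPairs (Steep v) l → All (λ x → M ≤ v x) l → Separated v l
    steep⇒separated v steep big α β α≢β α≤E β≤E 0≤c 0≤d m s long with ≢⇒≺⊎≻ α β α≢β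
    ... | inj₁ α≺β = steep-≺ v steep big α≺β α≤E β≤E 0≤c 0≤d m s long
    ... | inj₂ β≺α =
      let (l′ , s′ , long′ , cmp) = steep-≺ v steep big β≺α β≤E α≤E 0≤d 0≤c m s long in l′ , s′ , long′ , Sum.swap cmp

-- Monotone sublists, doubling distances and squaring ratios.

module Scales (ℝ : RealField) {A : Set} {_◁_ : Rel A 0ℓ} where
  open OrderedField ℝ
  open Separation ℝ

  -- Without a long increasing chain there is a long list along which `v` never increases. A second
  -- application of the dichotomy to it gives a strictly decreasing chain, to be reversed, or values
  -- incomparable both ways and hence equal; two applications make the bound cubic.
  monotone-sublist : ∀ (v : A → Carrier) m {l} → Oriented _◁_ l → m ℕ.* (m ℕ.* m) ℕ.< length l →
    ∃ λ l′ → Oriented _◁_ l′ × m ℕ.< length l′ ×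
             (AllPairs (λ x y → v x ≡ v y) l′ ⊎ AllPairs (λ x y → v x < v y) l′)
  monotone-sublist v m {l} ori long
    with chain-or-antichain {R = λ x y → v x < v y} (λ x y → v x <? v y) <-trans m (m ℕ.* m) l long
    where open IsStrictTotalOrder isStrictTotalOrder using (_<?_)
  ... | inj₁ (c , s , inc , long₁) = c , Oriented-⊆ s ori , long₁ , inj₂ inc
  ... | inj₂ (c , s , dec , long₁)
    with chain-or-antichain {R = λ x y → v y < v x} (λ x y → v y <? v x) (flip <-trans) m m c long₁
    where open IsStrictTotalOrder isStrictTotalOrder using (_<?_)
  ... | inj₁ (d , t , inc , long₂) =
    reverse d , Oriented-reverse (Oriented-⊆ (⊆-trans t s) ori) ,
    subst (m ℕ.<_) (sym (Listₚ.length-reverse d)) long₂ , inj₂ (AllPairs-reverse inc)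
  ... | inj₂ (d , t , ndec , long₂) =
    d , Oriented-⊆ (⊆-trans t s) ori , long₂ ,
    inj₁ (AllPairs.zipWith equal (ndec , AllPairs-resp-⊆ t dec))
    where
    equal : ∀ {x y} → ¬ (v y < v x) × ¬ (v x < v y) → v x ≡ v y
    equal {x} {y} (≮ , ≯) with compare (v x) (v y)
    ... | tri< lt _ _ = ⊥-elim (≯ lt)
    ... | tri≈ _ eq _ = eq
    ... | tri> _ _ gt = ⊥-elim (≮ gt)

  -- The hypothesis is `b - a ≤ c - b` without subtraction; adding `b - a` to both sides doubles the
  -- distance from `a`.
  recenter : ∀ {a b c} → b + b ≤ a + c → 2r * (b + - a) ≤ c + - a
  recenter {a} {b} {c} h = begin
    2r * (b + - a)
      ≡⟨ solve 2 (λ b n → (con 1 :+ con 1) :* (b :+ n) := (b :+ b) :+ (n :+ n)) refl b (- a) ⟩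
    (b + b) + (- a + - a)      ≤⟨ +-monoˡ-≤ (- a + - a) h ⟩
    (a + c) + (- a + - a)      ≡⟨ solve 3 (λ a c n → (a :+ c) :+ (n :+ n) := (c :+ n) :+ (a :+ n)) refl a c (- a) ⟩
    (c + - a) + (a + - a)      ≡⟨ cong ((c + - a) +_) (-‿inverseʳ a) ⟩
    (c + - a) + 0r             ≡⟨ +-identityʳ _ ⟩
    c + - a                    ∎

  -‿mono-≤ : ∀ {a b} → a ≤ b → - b ≤ - a
  -‿mono-≤ {a} {b} a≤b = begin
    - b                ≡⟨ +-identityˡ (- b) ⟨
    0r + - b           ≡⟨ cong (_+ - b) (-‿inverseʳ a) ⟨
    (a + - a) + - b    ≤⟨ +-monoˡ-≤ (- b) (+-monoˡ-≤ (- a) a≤b) ⟩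
    (b + - a) + - b    ≡⟨ solve 3 (λ b m n → (b :+ m) :+ n := m :+ (b :+ n)) refl b (- a) (- b) ⟩
    - a + (b + - b)    ≡⟨ cong (- a +_) (-‿inverseʳ b) ⟩
    - a + 0r           ≡⟨ +-identityʳ (- a) ⟩
    - a                ∎

  -- One form for both sides of the centre `t`: the slope `s` will be `1r` above it and `- 1r`
  -- below.
  Affine : (A → Carrier) → (A → Carrier) → Set
  Affine v δ = ∃₂ λ t s → ∀ x → v x ≡ t + s * δ x

  doubling-sublist : ∀ (v : A → Carrier) m {l} → Oriented _◁_ l → AllPairs (λ x y → v x < v y) l →
    2 ℕ.^ (m ℕ.+ m) ℕ.< length l →
    ∃₂ λ l′ δ → Oriented _◁_ l′ × m ℕ.≤ length l′ × Affine v δ ×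
      All (λ x → 0r < δ x) l′ × AllPairs (λ x y → 2r * δ x ≤ δ y) l′
  doubling-sublist v m {l} ori inc long
    with doubling-distances {_⊑_ = λ x y → v x ≤ v y}
           {L = λ x y z → v y + v y ≤ v x + v z} {U = λ x y z → v x + v z ≤ v y + v y}
           (λ _ → ≤-refl) (λ _ → ≤-refl) (λ x y z → ≤-total _ _)
           (λ _ h x≤t v≤y → ≤-trans (+-mono-≤ v≤y v≤y) (≤-trans h (+-monoˡ-≤ _ x≤t)))
           (λ _ h y≤u t≤z → ≤-trans (+-monoʳ-≤ _ t≤z) (≤-trans h (+-mono-≤ y≤u y≤u)))
           m l (AllPairs.map <⇒≤ inc) long
  ... | us , t , vs , s , inj₂ (Vs , long′) =
    vs , (λ x → v x + - v t) , Oriented-⊆ vs⊆ ori , long′ ,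
    (v t , 1r , λ x → sym (trans (cong (v t +_) (*-identityˡ _)) (trans (+-comm _ _) (x-y+y≡x (v x) (v t))))) ,
    All.map x<y⇒0<y-x (AllPairs.head (AllPairs-resp-⊆ t∷vs⊆ inc)) ,
    AllPairs.map recenter Vs
    where
    t∷vs⊆ = ⊆-trans (++⁺ˡ us ⊆-refl) s
    vs⊆ = ⊆-trans (t ∷ʳ ⊆-refl) t∷vs⊆
  -- Below the centre the distances shrink along `us`. Negating all values reduces their comparison
  -- to the previous case, and reversing the list makes them grow.
  ... | us , t , vs , s , inj₁ (Us , long′) =
    reverse us , (λ x → v t + - v x) , Oriented-reverse (Oriented-⊆ us⊆ ori) ,
    subst (m ℕ.≤_) (sym (Listₚ.length-reverse us)) long′ ,
    (v t , - 1r , reflect) ,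
    All-reverse (All.map (x<y⇒0<y-x ∘ All.head) (proj₂ (proj₂ (AllPairs-++⁻ us (AllPairs-resp-⊆ s inc))))) ,
    AllPairs-reverse (AllPairs.map (λ {x} {y} h → subst₂ _≤_ (cong (2r *_) (neg y)) (neg x) (recenter { - v t} (negated x y h))) Us)
    where
    us⊆ = ⊆-trans (++⁺ʳ (t ∷ vs) ⊆-refl) s
    neg : ∀ x → - v x + - - v t ≡ v t + - v x
    neg x = trans (cong (- v x +_) (-‿involutive (v t))) (+-comm _ _)
    negated : ∀ x y → v x + v t ≤ v y + v y → - v y + - v y ≤ - v t + - v x
    negated x y h = subst₂ _≤_ (sym (-‿+-comm (v y) (v y))) (trans (sym (-‿+-comm (v x) (v t))) (+-comm _ _)) (-‿mono-≤ h)
    reflect : ∀ x → v x ≡ v t + - 1r * (v t + - v x)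
    reflect x = sym (begin-equality
      v t + - 1r * (v t + - v x)     ≡⟨ cong (v t +_) (trans (sym (-‿distribˡ-* 1r _)) (cong -_ (*-identityˡ _))) ⟩
      v t + - (v t + - v x)          ≡⟨ cong (v t +_) (sym (-‿+-comm (v t) (- v x))) ⟩
      v t + (- v t + - - v x)        ≡⟨ +-assoc _ _ _ ⟨
      (v t + - v t) + - - v x        ≡⟨ cong₂ _+_ (-‿inverseʳ (v t)) (-‿involutive (v x)) ⟩
      0r + v x                       ≡⟨ +-identityˡ (v x) ⟩
      v x                            ∎)

  -- Ratios take the place of differences: `L` and `U` compare `δ y / δ x` with `δ z / δ y` after
  -- clearing denominators, so doubling a distance becomes squaring a ratio. The preorder carries
  -- positivity, which makes these products monotone. The assumed ratio `M` between entries keeps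
  -- every `ε` at or above `M`.
  squaring-sublist : ∀ (δ : A → Carrier) M → 1r ≤ M → ∀ m {l} → Oriented _◁_ l →
    All (λ x → 0r < δ x) l → AllPairs (λ x y → M * δ x ≤ δ y) l → 2 ℕ.^ (m ℕ.+ m) ℕ.< length l →
    ∃ λ τ → ∃₂ λ l′ ε → 0r < τ × Oriented _◁_ l′ × m ℕ.≤ length l′ ×
      All (λ x → 0r < δ x) l′ × (All (λ x → δ x ≡ τ * ε x) l′ ⊎ All (λ x → δ x * ε x ≡ τ) l′) ×
      All (λ x → M ≤ ε x) l′ × AllPairs (λ x y → ε x * ε x ≤ ε y) l′
  squaring-sublist δ M 1≤M m {l} ori pos inc long
    with doubling-distances {_⊑_ = λ x y → 0r < δ x × 0r < δ y × δ x ≤ δ y}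
           {L = λ x y z → δ y * δ y ≤ δ x * δ z} {U = λ x y z → δ x * δ z ≤ δ y * δ y}
           (λ (0<x , _) → 0<x , 0<x , ≤-refl) (λ (_ , 0<y , _) → 0<y , 0<y , ≤-refl) (λ x y z → ≤-total _ _)
           (λ (_ , 0<z , _) h (_ , _ , x≤t) (0<v , 0<y , v≤y) →
              ≤-trans (*-mono-≤ (<⇒≤ 0<v) (<⇒≤ 0<y) v≤y v≤y) (≤-trans h (*-monoʳ-≤ (<⇒≤ 0<z) x≤t)))
           (λ (0<x , _) h (0<y , 0<u , y≤u) (_ , _ , t≤z) →
              ≤-trans (*-monoˡ-≤ (<⇒≤ 0<x) t≤z) (≤-trans h (*-mono-≤ (<⇒≤ 0<y) (<⇒≤ 0<u) y≤u y≤u)))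
           m l (AllPairs-map-All (λ 0<x 0<y h → 0<x , 0<y , ≤-trans (x≤1*x 1≤M (<⇒≤ 0<x)) h) pos inc) long
  ... | us , t , vs , s , inj₂ (Vs , long′) =
    δ t , vs , ε , 0<τ , Oriented-⊆ vs⊆ ori , long′ , All-resp-⊆ vs⊆ pos , inj₁ (All.tabulate (λ {x} _ → scaled x)) ,
    All.map (λ {x} h → *-cancelˡ-≤ 0<τ (subst₂ _≤_ (*-comm M τ) (scaled x) h)) (AllPairs.head (AllPairs-resp-⊆ t∷vs⊆ inc)) ,
    AllPairs.map (λ {x} {y} → square x y) Vs
    where
    t∷vs⊆ = ⊆-trans (++⁺ˡ us ⊆-refl) s
    vs⊆ = ⊆-trans (t ∷ʳ ⊆-refl) t∷vs⊆
    τ = δ t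
    0<τ : 0r < τ
    0<τ = All.head (All-resp-⊆ t∷vs⊆ pos)
    ε : A → Carrier
    ε x = τ ⁻¹ * δ x
    scaled : ∀ x → δ x ≡ τ * ε x
    scaled x = sym (trans (sym (*-assoc τ (τ ⁻¹) (δ x))) (trans (cong (_* δ x) (⁻¹-inverse τ (λ eq → <-irrefl (sym eq) 0<τ))) (*-identityˡ (δ x))))
    square : ∀ x y → δ x * δ x ≤ τ * δ y → ε x * ε x ≤ ε y
    square x y h = *-cancelˡ-≤ (*-pos _ _ 0<τ 0<τ) (begin
      (τ * τ) * (ε x * ε x)    ≡⟨ solve 2 (λ t e → (t :* t) :* (e :* e) := (t :* e) :* (t :* e)) refl τ (ε x) ⟩
      (τ * ε x) * (τ * ε x)    ≡⟨ cong₂ _*_ (scaled x) (scaled x) ⟨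
      δ x * δ x                ≤⟨ h ⟩
      τ * δ y                  ≡⟨ cong (τ *_) (scaled y) ⟩
      τ * (τ * ε y)            ≡⟨ *-assoc τ τ _ ⟨
      (τ * τ) * ε y            ∎)
  ... | us , t , vs , s , inj₁ (Us , long′) =
    δ t , reverse us , ε , 0<τ , Oriented-reverse (Oriented-⊆ us⊆ ori) ,
    subst (m ℕ.≤_) (sym (Listₚ.length-reverse us)) long′ ,
    All-reverse pos-us , inj₂ (All-reverse (All.map (λ {x} → inverse x) pos-us)) ,
    All-reverse (All.zipWith (λ { {x} (0<x , (h ∷ _)) → *-cancelˡ-≤ 0<x (subst₂ _≤_ (*-comm M (δ x)) (sym (inverse x 0<x)) h) })
                  (pos-us , proj₂ (proj₂ (AllPairs-++⁻ us (AllPairs-resp-⊆ s inc))))) ,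
    AllPairs-reverse (AllPairs-map-All (λ {x} {y} → square x y) pos-us Us)
    where
    us⊆ = ⊆-trans (++⁺ʳ (t ∷ vs) ⊆-refl) s
    pos-us = All-resp-⊆ us⊆ pos
    τ = δ t
    0<τ : 0r < τ
    0<τ = All.head (Allₚ.++⁻ʳ us (All-resp-⊆ s pos))
    ε : A → Carrier
    ε x = δ x ⁻¹ * τ
    inverse : ∀ x → 0r < δ x → δ x * ε x ≡ τ
    inverse x 0<x = trans (sym (*-assoc (δ x) _ τ)) (trans (cong (_* τ) (⁻¹-inverse (δ x) (λ eq → <-irrefl (sym eq) 0<x))) (*-identityˡ τ))
    square : ∀ x y → 0r < δ x → 0r < δ y → δ x * τ ≤ δ y * δ y → ε y * ε y ≤ ε x
    square x y 0<x 0<y h = *-cancelˡ-≤ (*-pos _ _ 0<y 0<y) (begin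
      (δ y * δ y) * (ε y * ε y)
        ≡⟨ solve 2 (λ t e → (t :* t) :* (e :* e) := (t :* e) :* (t :* e)) refl (δ y) (ε y) ⟩
      (δ y * ε y) * (δ y * ε y)   ≡⟨ cong (λ z → z * z) (inverse y 0<y) ⟩
      τ * τ                       ≡⟨ cong (_* τ) (inverse x 0<x) ⟨
      (δ x * ε x) * τ             ≡⟨ solve 3 (λ d e t → (d :* e) :* t := (d :* t) :* e) refl (δ x) (ε x) τ ⟩
      (δ x * τ) * ε x             ≤⟨ *-monoʳ-≤ 0≤εx h ⟩
      (δ y * δ y) * ε x           ∎)
      where
      0≤εx : 0r ≤ ε x
      0≤εx = <⇒≤ (*-pos _ _ (⁻¹-pos 0<x) 0<τ)

-- Lengths needed by the stages, and extraction of separated scales.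

2^-suc : ∀ n → 2 ℕ.^ suc n ≡ 2 ℕ.^ n ℕ.+ 2 ℕ.^ n
2^-suc n = cong (2 ℕ.^ n ℕ.+_) (ℕₚ.+-identityʳ (2 ℕ.^ n))

-- The lengths are computed backwards: each is what the stage of its name must deliver for the later
-- stages, and `extractionLength` is the input. The factor `2 ^ (2 + E)` pays for `power-thin`, and
-- `2 ^ j` for `ratio-thin`.
squaringLength : ℕ → ℕ → ℕ
squaringLength E m = 2 ℕ.^ (2 ℕ.+ E) ℕ.* m

doublingLength monotoneLength extractionLength : ℕ → ℕ → ℕ → ℕ
doublingLength   j E m = let n = squaringLength E m in 2 ℕ.^ j ℕ.* suc (2 ℕ.^ (n ℕ.+ n))
monotoneLength   j E m = let n = doublingLength j E m in 2 ℕ.^ (n ℕ.+ n)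
extractionLength j E m = let n = monotoneLength j E m in suc (n ℕ.* (n ℕ.* n))

n≤2^j*n : ∀ j n → n ℕ.≤ 2 ℕ.^ j ℕ.* n
n≤2^j*n j n = ℕₚ.m≤n*m n (2 ℕ.^ j) {{ℕₚ.m^n≢0 2 j}}

-- Serves the case of equal values, where extraction ends after the first stage.
m≤monotoneLength : ∀ j E m → m ℕ.≤ monotoneLength j E m
m≤monotoneLength j E m =
  ℕₚ.≤-trans (n≤2^j*n (2 ℕ.+ E) m) (ℕₚ.≤-trans (double n₁) (ℕₚ.≤-trans (ℕₚ.n≤1+n _) (ℕₚ.≤-trans (n≤2^j*n j _) (double n₂))))
  where
  n₁ = squaringLength E m
  n₂ = doublingLength j E m
  double : ∀ n → n ℕ.≤ 2 ℕ.^ (n ℕ.+ n)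
  double n = ℕₚ.≤-trans (ℕₚ.m≤m+n n n) (n≤2^n (n ℕ.+ n))

module Extraction (ℝ : RealField) {A : Set} {_◁_ : Rel A 0ℓ} where
  open OrderedField ℝ
  open Separation ℝ
  open Scales ℝ {A} {_◁_}

  ratio-thin : ∀ (δ : A → Carrier) j m {l} → AllPairs (λ x y → 2r * δ x ≤ δ y) l → 2 ℕ.^ j ℕ.* m ℕ.≤ length l →
    ∃ λ l′ → l′ ⊆ l × m ℕ.≤ length l′ × AllPairs (λ x y → 2r ^ (2 ℕ.^ j) * δ x ≤ δ y) l′
  ratio-thin δ j m inc long =
    thin {R = λ j x y → 2r ^ (2 ℕ.^ j) * δ x ≤ δ y} compose j m
      (AllPairs.map (λ {x} {y} → subst (λ c → c * δ x ≤ δ y) (sym (*-identityʳ 2r))) inc) long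
    where
    compose : ∀ j {x y z} → 2r ^ (2 ℕ.^ j) * δ x ≤ δ y → 2r ^ (2 ℕ.^ j) * δ y ≤ δ z → 2r ^ (2 ℕ.^ suc j) * δ x ≤ δ z
    compose j {x} {y} {z} xy yz = begin
      2r ^ (2 ℕ.^ suc j) * δ x
        ≡⟨ cong (_* δ x) (trans (cong (2r ^_) (2^-suc j)) (^-homo-* 2r (2 ℕ.^ j) (2 ℕ.^ j))) ⟩
      (c * c) * δ x                  ≡⟨ *-assoc c c (δ x) ⟩
      c * (c * δ x)                  ≤⟨ *-monoˡ-≤ (<⇒≤ (0<^ (2 ℕ.^ j) (1≤⇒0< 1≤2))) xy ⟩
      c * δ y                        ≤⟨ yz ⟩
      δ z                            ∎
      where c = 2r ^ (2 ℕ.^ j)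

  power-thin : ∀ (ε : A → Carrier) j m {l} → All (λ x → 0r < ε x) l → AllPairs (λ x y → ε x * ε x ≤ ε y) l →
    2 ℕ.^ j ℕ.* m ℕ.≤ length l →
    ∃ λ l′ → l′ ⊆ l × m ℕ.≤ length l′ × AllPairs (λ x y → ε x ^ (2 ℕ.^ (2 ℕ.^ j)) ≤ ε y) l′
  power-thin ε j m {l} pos inc long =
    let (l′ , s , long′ , h) = thin {R = R} compose j m
          (AllPairs-map-All (λ {x} {y} 0<x _ h → 0<x , subst (λ c → ε x * c ≤ ε y) (sym (*-identityʳ (ε x))) h) pos inc) long
    in l′ , s , long′ , AllPairs.map proj₂ h
    where
    R : ℕ → Rel A 0ℓ
    R j x y = 0r < ε x × ε x ^ (2 ℕ.^ (2 ℕ.^ j)) ≤ ε y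
    compose : ∀ j {x y z} → R j x y → R j y z → R (suc j) x z
    compose j {x} {y} {z} (0<x , xy) (_ , yz) = 0<x , (begin
      ε x ^ (2 ℕ.^ (2 ℕ.^ suc j))
        ≡⟨ cong (ε x ^_) (trans (cong (2 ℕ.^_) (2^-suc j)) (ℕₚ.^-distribˡ-+-* 2 (2 ℕ.^ j) (2 ℕ.^ j))) ⟩
      ε x ^ (a ℕ.* a)               ≡⟨ ^-assocʳ (ε x) a a ⟨
      (ε x ^ a) ^ a                 ≤⟨ ^-monoˡ-≤ a (0<^ a 0<x) xy ⟩
      ε y ^ a                       ≤⟨ yz ⟩
      ε z                           ∎)
      where a = 2 ℕ.^ (2 ℕ.^ j)

  module _ (M : Carrier) (E : ℕ) (1≤M : 1r ≤ M) where

    -- By homogeneity `τ` leaves a monomial with the total degree as exponent and joins the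
    -- coefficient, which `Separated` leaves arbitrary.
    separated-scaled : ∀ {τ} {δ ε : A → Carrier} {l} → 0r < τ → All (λ x → δ x ≡ τ * ε x) l →
                       Separated M E 1≤M ε l → Separated M E 1≤M δ l
    separated-scaled {τ} {δ} {ε} {l} 0<τ eq sep α β α≢β α≤E β≤E {c} {d} 0≤c 0≤d m s long
      with sep α β α≢β α≤E β≤E (0≤τ^ α 0≤c) (0≤τ^ β 0≤d) m s long
      where
      0≤τ^ : ∀ {k} (γ : Vec ℕ k) {b} → 0r ≤ b → 0r ≤ b * τ ^ Vec.sum γ
      0≤τ^ γ 0≤b = 0≤* 0≤b (<⇒≤ (0<^ (Vec.sum γ) 0<τ))
    ... | l′ , s′ , long′ , cmp =
      l′ , s′ , long′ , Sum.map (transfer α β c d) (transfer β α d c) cmp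
      where
      transfer : ∀ {k} (α β : Vec ℕ k) c d → Dominated M E 1≤M ε l′ (c * τ ^ Vec.sum α) α (d * τ ^ Vec.sum β) β →
                 Dominated M E 1≤M δ l′ c α d β
      transfer α β c d h e t =
        subst₂ _≤_ (cong (M *_) (scale α c)) (scale β d) (h e t)
        where
        scale : ∀ γ b → (b * τ ^ Vec.sum γ) * monomial γ (ε ∘ e) ≡ b * monomial γ (δ ∘ e)
        scale γ b = trans (*-assoc b _ _) (cong (b *_) (sym (monomial-scale γ
          (Allₚ.tabulate⁻ (All-resp-⊆ (⊆-trans t (⊆-trans s′ s)) eq)))))

    -- In monomials of δ = τ / ε the two exponent vectors trade places.
    separated-inverse : ∀ {τ} {δ ε : A → Carrier} {l} → 0r < τ → All (λ x → 0r < ε x) l → All (λ x → δ x * ε x ≡ τ) l →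
                        Separated M E 1≤M ε l → Separated M E 1≤M δ l
    separated-inverse {τ} {δ} {ε} {l} 0<τ pos eq sep α β α≢β α≤E β≤E {c} {d} 0≤c 0≤d m s long
      with sep β α (α≢β ∘ sym) β≤E α≤E (0≤τ^ α 0≤c) (0≤τ^ β 0≤d) m s long
      where
      0≤τ^ : ∀ {k} (γ : Vec ℕ k) {b} → 0r ≤ b → 0r ≤ b * τ ^ Vec.sum γ
      0≤τ^ γ 0≤b = 0≤* 0≤b (<⇒≤ (0<^ (Vec.sum γ) 0<τ))
    ... | l′ , s′ , long′ , cmp =
      l′ , s′ , long′ , Sum.map (transfer α β c d) (transfer β α d c) cmp
      where
      transfer : ∀ {k} (α β : Vec ℕ k) c d → Dominated M E 1≤M ε l′ (c * τ ^ Vec.sum α) β (d * τ ^ Vec.sum β) α →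
                 Dominated M E 1≤M δ l′ c α d β
      -- Multiplying by `ε^ α * ε^ β` clears the denominators: on each side one factor turns the
      -- monomial in `δ` into a power of `τ`, and the other, with the opposite exponent vector,
      -- remains.
      transfer α β c d h e t = *-cancelʳ-≤ (*-pos _ _ (0<ε α) (0<ε β)) (begin
        (M * (c * δ^ α)) * (ε^ α * ε^ β)
          ≡⟨ solve 5 (λ m c x y z → (m :* (c :* x)) :* (y :* z) := m :* ((c :* (x :* y)) :* z)) refl M c (δ^ α) (ε^ α) (ε^ β) ⟩
        M * ((c * (δ^ α * ε^ α)) * ε^ β)        ≡⟨ cong (λ x → M * ((c * x) * ε^ β)) (scale α) ⟩
        M * ((c * τ ^ Vec.sum α) * ε^ β)        ≤⟨ h e t ⟩
        (d * τ ^ Vec.sum β) * ε^ α              ≡⟨ cong (λ x → (d * x) * ε^ α) (scale β) ⟨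
        (d * (δ^ β * ε^ β)) * ε^ α
          ≡⟨ solve 4 (λ d x y z → (d :* (x :* y)) :* z := (d :* x) :* (z :* y)) refl d (δ^ β) (ε^ β) (ε^ α) ⟩
        (d * δ^ β) * (ε^ α * ε^ β)              ∎)
        where
        t′ = ⊆-trans t (⊆-trans s′ s)
        δ^ = λ γ → monomial γ (δ ∘ e)
        ε^ = λ γ → monomial γ (ε ∘ e)
        0<ε : ∀ γ → 0r < ε^ γ
        0<ε γ = monomial-pos γ (Allₚ.tabulate⁻ (All-resp-⊆ t′ pos))
        monomial-1 : ∀ {k} (γ : Vec ℕ k) → monomial γ (λ _ → 1r) ≡ 1r
        monomial-1 []      = refl
        monomial-1 (a ∷ γ) = trans (cong₂ _*_ (1^ a) (monomial-1 γ)) (*-identityˡ 1r)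
          where
          1^ : ∀ a → 1r ^ a ≡ 1r
          1^ zero    = refl
          1^ (suc a) = trans (*-identityˡ _) (1^ a)
        scale : ∀ γ → δ^ γ * ε^ γ ≡ τ ^ Vec.sum γ
        scale γ = trans (monomial-* γ (δ ∘ e) (ε ∘ e))
          (trans (monomial-scale γ {τ} {y = λ _ → 1r} (λ i → trans (Allₚ.tabulate⁻ (All-resp-⊆ t′ eq) i) (sym (*-identityʳ τ))))
          (trans (cong (τ ^ Vec.sum γ *_) (monomial-1 γ)) (*-identityʳ _)))

  1≤2^ : ∀ n → 1r ≤ 2r ^ n
  1≤2^ n = 1≤^ n 1≤2

  separated-sublist : ∀ (v : A → Carrier) j E m {l} → Oriented _◁_ l → extractionLength j E m ℕ.≤ length l →
    ∃ λ l′ → Oriented _◁_ l′ × m ℕ.≤ length l′ ×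
      (AllPairs (λ x y → v x ≡ v y) l′ ⊎
       ∃ λ δ → Affine v δ × All (λ x → 0r < δ x) l′ × Separated (2r ^ (2 ℕ.^ j)) E (1≤2^ (2 ℕ.^ j)) δ l′)
  separated-sublist v j E m ori long with monotone-sublist v (monotoneLength j E m) ori long
  ... | l₁ , ori₁ , long₁ , inj₁ same =
    l₁ , ori₁ , ℕₚ.≤-trans (m≤monotoneLength j E m) (ℕₚ.<⇒≤ long₁) , inj₁ same
  ... | l₁ , ori₁ , long₁ , inj₂ inc₁
    with doubling-sublist v (doublingLength j E m) ori₁ inc₁ long₁
  ... | l₂ , δ , ori₂ , long₂ , affine , pos₂ , inc₂
    -- The ratio is widened to `M` before squaring, so that the quotients `ε` start at `M`.
    with ratio-thin δ j _ inc₂ long₂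
  ... | l₃ , s₃ , long₃ , inc₃
    with squaring-sublist δ (2r ^ (2 ℕ.^ j)) (1≤2^ (2 ℕ.^ j)) (squaringLength E m) (Oriented-⊆ s₃ ori₂) (All-resp-⊆ s₃ pos₂) inc₃ long₃
  ... | τ , l₄ , ε , 0<τ , ori₄ , long₄ , pos₄ , rel , big , inc₄
    with power-thin ε (2 ℕ.+ E) m (All.map (<-≤-trans (1≤⇒0< (1≤2^ (2 ℕ.^ j)))) big) inc₄ long₄
  ... | l₅ , s₅ , long₅ , inc₅ =
    l₅ , Oriented-⊆ s₅ ori₄ , long₅ , inj₂ (δ , affine , All-resp-⊆ s₅ pos₄ , separated (Sum.map (All-resp-⊆ s₅) (All-resp-⊆ s₅) rel))
    where
    M = 2r ^ (2 ℕ.^ j)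
    1≤M = 1≤2^ (2 ℕ.^ j)
    big₅ = All-resp-⊆ s₅ big
    -- Thinning yields the exponent `2 ^ (2 ^ (2 + E))`; it is lowered to the `2 + E` of `Steep`,
    -- which is legitimate as all scales are at least one.
    ε-separated : Separated M E 1≤M ε l₅
    ε-separated = steep⇒separated M E 1≤M ε (AllPairs-map-All (λ M≤x _ → ≤-trans (^-monoʳ-≤ (≤-trans 1≤M M≤x)
      (ℕₚ.≤-trans (n≤2^n (2 ℕ.+ E)) (n≤2^n _)))) big₅ inc₅) big₅
    separated : All (λ x → δ x ≡ τ * ε x) l₅ ⊎ All (λ x → δ x * ε x ≡ τ) l₅ → Separated M E 1≤M δ l₅
    separated (inj₁ eq) = separated-scaled M E 1≤M 0<τ eq ε-separated
    separated (inj₂ eq) = separated-inverse M E 1≤M 0<τ (All.map (<-≤-trans (1≤⇒0< 1≤M)) big₅) eq ε-separated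

-- Dominant terms, signs and expansion of polynomials.

maximum : {X : Set} {R : Rel X 0ℓ} → Transitive R → ∀ {xs} → AllPairs (λ x y → R x y ⊎ R y x) xs →
          xs ≡ [] ⊎ ∃₂ λ y ys → xs ↭ y ∷ ys × All (R y) ys
maximum R-trans []       = inj₁ refl
maximum R-trans {x ∷ xs} (p ∷ ps) with maximum R-trans ps
... | inj₁ refl = inj₂ (x , [] , ↭-refl , [])
... | inj₂ (y , ys , perm , top) with All.lookup p (∈-resp-↭ (↭-sym perm) (here refl))
... | inj₁ Rxy = inj₂ (x , y ∷ ys , ↭-prep x perm , Rxy ∷ All.map (R-trans Rxy) top)
... | inj₂ Ryx = inj₂ (y , x ∷ ys , ↭-trans (↭-prep x perm) (↭-swap x y ↭-refl) , Ryx ∷ top)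

refinable-mono : {A : Set} {l₀ : List A} {P : List A → Set} {c d : ℕ} → c ℕ.≤ d → Refinable l₀ c P → Refinable l₀ d P
refinable-mono c≤d r m s long = r m s (ℕₚ.≤-trans (ℕₚ.*-monoˡ-≤ m c≤d) long)

product-const : {X : Set} (c : ℕ) (xs : List X) → product (map (λ _ → c) xs) ≡ c ℕ.^ length xs
product-const c []       = refl
product-const c (x ∷ xs) = cong (c ℕ.*_) (product-const c xs)

length-cartesianProductWith : {X Y Z : Set} (f : X → Y → Z) (xs : List X) (ys : List Y) →
                              length (cartesianProductWith f xs ys) ≡ length xs ℕ.* length ys
length-cartesianProductWith f []       ys = refl
length-cartesianProductWith f (x ∷ xs) ys = trans (Listₚ.length-++ (map (f x) ys))
  (cong₂ ℕ._+_ (Listₚ.length-map (f x) ys) (length-cartesianProductWith f xs ys))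

sum-zeros : ∀ k → Vec.sum (replicate k 0) ≡ 0
sum-zeros zero    = refl
sum-zeros (suc k) = sum-zeros k

sum-unit : ∀ {k} (i : Fin k) → Vec.sum (replicate k 0 [ i ]≔ 1) ≡ 1
sum-unit {suc k} zero = cong suc (sum-zeros k)
sum-unit (suc i)      = sum-unit i

sum-zipWith-+ : ∀ {k} (α β : Vec ℕ k) → Vec.sum (zipWith ℕ._+_ α β) ≡ Vec.sum α ℕ.+ Vec.sum β
sum-zipWith-+ []      []      = refl
sum-zipWith-+ (a ∷ α) (b ∷ β) = trans (cong (a ℕ.+ b ℕ.+_) (sum-zipWith-+ α β)) (+-middle a b _ _)
  where
  open CommutativeSemigroupProperties ℕₚ.+-commutativeSemigroup using () renaming (interchange to +-middle)

-- Together with `degree`, a bound on the expansion that is read off the syntax, hence the same for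
-- every sequence. A variable counts as two terms because it becomes `t + s * y`.
size : ∀ {k} → Poly k → ℕ
size (const q) = 1
size (var i)   = 2
size (p ⊕ q)   = size p ℕ.+ size q
size (p ⊗ q)   = size p ℕ.* size q

degree : ∀ {k} → Poly k → ℕ
degree (const q) = 0
degree (var i)   = 1
degree (p ⊕ q)   = degree p ℕ.+ degree q
degree (p ⊗ q)   = degree p ℕ.+ degree q

data Sign : Set where
  neg zer pos : Sign

module Polynomials (ℝ : RealField) where
  open OrderedField ℝ
  open Separation ℝ

  HasSign : Sign → Carrier → Set
  HasSign neg x = x < 0r
  HasSign zer x = x ≡ 0r
  HasSign pos x = 0r < x

  sign : ∀ x → ∃ λ σ → HasSign σ x
  sign x with compare x 0r
  ... | tri< x<0 _ _ = neg , x<0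
  ... | tri≈ _ x≡0 _ = zer , x≡0
  ... | tri> _ _ 0<x = pos , 0<x

  0<-x⇒x<0 : ∀ {x} → 0r < - x → x < 0r
  0<-x⇒x<0 {x} 0<-x = subst₂ _<_ (+-identityˡ x) (-‿inverseˡ x) (+-mono-< _ _ x 0<-x)

  abs : Carrier → Carrier
  abs x with compare x 0r
  ... | tri< _ _ _ = - x
  ... | tri≈ _ _ _ = x
  ... | tri> _ _ _ = x

  x≤∣x∣ : ∀ x → x ≤ abs x
  x≤∣x∣ x with compare x 0r
  ... | tri< x<0 _ _ = <⇒≤ (<-trans x<0 (x<0⇒0<-x x<0))
  ... | tri≈ _ _ _   = ≤-refl
  ... | tri> _ _ _   = ≤-refl

  -x≤∣x∣ : ∀ x → - x ≤ abs x
  -x≤∣x∣ x with compare x 0r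
  ... | tri< _ _ _      = ≤-refl
  ... | tri≈ _ refl _   = ≤-reflexive -0#≈0#
  ... | tri> _ _ 0<x    = <⇒≤ (<-trans (0<-x⇒x<0 (subst (0r <_) (sym (-‿involutive x)) 0<x)) 0<x)

  0≤∣x∣ : ∀ x → 0r ≤ abs x
  0≤∣x∣ x with compare x 0r
  ... | tri< x<0 _ _   = <⇒≤ (x<0⇒0<-x x<0)
  ... | tri≈ _ refl _  = ≤-refl
  ... | tri> _ _ 0<x   = <⇒≤ 0<x

  ∣x∣≤0⇒x≡0 : ∀ x → abs x ≤ 0r → x ≡ 0r
  ∣x∣≤0⇒x≡0 x ≤0 with compare x 0r
  ... | tri< x<0 _ _  = ⊥-elim (<⇒≱ (x<0⇒0<-x x<0) ≤0)
  ... | tri≈ _ x≡0 _  = x≡0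
  ... | tri> _ _ 0<x  = ⊥-elim (<⇒≱ 0<x ≤0)

  x>0⇒∣x∣≡x : ∀ x → 0r < x → abs x ≡ x
  x>0⇒∣x∣≡x x 0<x with compare x 0r
  ... | tri< x<0 _ _  = ⊥-elim (<-irrefl refl (<-trans 0<x x<0))
  ... | tri≈ _ _ _    = refl
  ... | tri> _ _ _    = refl

  x<0⇒∣x∣≡-x : ∀ x → x < 0r → abs x ≡ - x
  x<0⇒∣x∣≡-x x x<0 with compare x 0r
  ... | tri< _ _ _    = refl
  ... | tri≈ _ refl _ = ⊥-elim (<-irrefl refl x<0)
  ... | tri> _ _ 0<x  = ⊥-elim (<-irrefl refl (<-trans 0<x x<0))

  sum : List Carrier → Carrier
  sum = foldr _+_ 0r

  sum-neg : ∀ ys → sum (map -_ ys) ≡ - sum ys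
  sum-neg []       = sym -0#≈0#
  sum-neg (y ∷ ys) = trans (cong (- y +_) (sum-neg ys)) (-‿+-comm y (sum ys))

  sum-zero : ∀ {ys} → All (_≡ 0r) ys → sum ys ≡ 0r
  sum-zero []            = refl
  sum-zero (refl ∷ eqs)  = trans (+-identityˡ _) (sum-zero eqs)

  module _ (M : Carrier) (1≤M : 1r ≤ M) where

    private
      0<M = 1≤⇒0< 1≤M
      0≤M = 1≤⇒0≤ 1≤M

    -- Adding the bounds gives `0 ≤ n x + M S` for `n` summands with sum `S`. Since `M` is at least
    -- `n + 1`, it follows that `M (x + S) ≥ x > 0`; the extra one provides strictness.
    dominant-positive : ∀ {x} → 0r < x → ∀ ys → All (λ y → 0r ≤ x + M * y) ys → fromℕ (suc (length ys)) ≤ M →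
                        0r < x + sum ys
    dominant-positive {x} 0<x ys bounds few = *-cancelˡ-< 0<M (begin-strict
      M * 0r                                   ≡⟨ zeroʳ M ⟩
      0r                                       <⟨ 0<x ⟩
      x                                        ≡⟨ +-identityʳ x ⟨
      x + 0r                                   ≤⟨ +-monoʳ-≤ x (total ys bounds) ⟩
      x + (fromℕ (length ys) * x + M * sum ys)
        ≡⟨ solve 4 (λ x n m s → x :+ (n :* x :+ m :* s) := (con 1 :+ n) :* x :+ m :* s) refl x _ M (sum ys) ⟩
      fromℕ (suc (length ys)) * x + M * sum ys ≤⟨ +-monoˡ-≤ (M * sum ys) (*-monoʳ-≤ (<⇒≤ 0<x) few) ⟩
      M * x + M * sum ys                       ≡⟨ distribˡ M x (sum ys) ⟨
      M * (x + sum ys)                         ∎)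
      where
      total : ∀ ys → All (λ y → 0r ≤ x + M * y) ys → 0r ≤ fromℕ (length ys) * x + M * sum ys
      total []       []       = ≤-reflexive (sym (trans (cong₂ _+_ (zeroˡ x) (zeroʳ M)) (+-identityʳ 0r)))
      total (y ∷ ys) (b ∷ bs) = begin
        0r                                                    ≡⟨ +-identityʳ 0r ⟨
        0r + 0r                                               ≤⟨ +-mono-≤ b (total ys bs) ⟩
        (x + M * y) + (fromℕ (length ys) * x + M * sum ys)
          ≡⟨ solve 5 (λ x m y n s → (x :+ m :* y) :+ (n :* x :+ m :* s) := (con 1 :+ n) :* x :+ m :* (y :+ s)) refl x M y _ (sum ys) ⟩
        fromℕ (suc (length ys)) * x + M * (y + sum ys)        ∎

    -- Here `n` is the negative of `c` and `a` an absolute value. With `n` as a parameter the lemma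
    -- applies to a coefficient `d` and to `- d` without double negations.
    compensated : ∀ {c n a m x} → c + n ≡ 0r → n ≤ a → 0r ≤ m → M * (a * m) ≤ x → 0r ≤ x + M * (c * m)
    compensated {c} {n} {a} {m} {x} c+n≡0 n≤a 0≤m Mam≤x = begin
      0r                           ≡⟨ zeroʳ M ⟨
      M * 0r                       ≡⟨ cong (M *_) (zeroˡ m) ⟨
      M * (0r * m)                 ≡⟨ cong (λ z → M * (z * m)) c+n≡0 ⟨
      M * ((c + n) * m)
        ≡⟨ solve 4 (λ k c n m → k :* ((c :+ n) :* m) := k :* (n :* m) :+ k :* (c :* m)) refl M c n m ⟩
      M * (n * m) + M * (c * m)    ≤⟨ +-monoˡ-≤ _ (*-monoˡ-≤ 0≤M (*-monoʳ-≤ 0≤m n≤a)) ⟩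
      M * (a * m) + M * (c * m)    ≤⟨ +-monoˡ-≤ _ Mam≤x ⟩
      x + M * (c * m)              ∎

  Term : ℕ → Set
  Term k = Carrier × Vec ℕ k

  evalT : ∀ {k} → (Fin k → Carrier) → Term k → Carrier
  evalT x (c , α) = c * monomial α x

  evalTs : ∀ {k} → (Fin k → Carrier) → List (Term k) → Carrier
  evalTs x ts = sum (map (evalT x) ts)

  -- The sign is that of the leading coefficient, hence chosen before the point `x`. If that
  -- coefficient is zero, domination forces all the others to be zero, so vanishing terms may stay
  -- in the list.
  leading-sign : ∀ M → 1r ≤ M → ∀ {k} (t : Term k) ts → fromℕ (suc (length ts)) ≤ M →
    ∃ λ σ → ∀ x → (∀ i → 0r < x i) →
      All (λ u → M * (abs (proj₁ u) * monomial (proj₂ u) x) ≤ abs (proj₁ t) * monomial (proj₂ t) x) ts →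
      HasSign σ (evalTs x (t ∷ ts))
  leading-sign M 1≤M (c , α) ts few with sign c
  ... | pos , 0<c = pos , λ x 0<x dom →
    dominant-positive M 1≤M (*-pos _ _ 0<c (monomial-pos α 0<x)) (map (evalT x) ts)
      (Allₚ.map⁺ (All.map (λ { {d , β} h → compensated M 1≤M (-‿inverseʳ d) (-x≤∣x∣ d) (<⇒≤ (monomial-pos β 0<x))
                                             (subst (λ a → _ ≤ a * monomial α x) (x>0⇒∣x∣≡x c 0<c) h) }) dom))
      (subst (λ n → fromℕ (suc n) ≤ M) (sym (Listₚ.length-map (evalT x) ts)) few)
  ... | neg , c<0 = neg , λ x 0<x dom → 0<-x⇒x<0 (subst (0r <_) (negated x)
    (dominant-positive M 1≤M (*-pos _ _ (x<0⇒0<-x c<0) (monomial-pos α 0<x)) (map -_ (map (evalT x) ts))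
      (Allₚ.map⁺ (Allₚ.map⁺ (All.map (λ { {d , β} h → subst (λ y → 0r ≤ - c * monomial α x + M * y) (sym (-‿distribˡ-* d _))
          (compensated M 1≤M (-‿inverseˡ d) (x≤∣x∣ d) (<⇒≤ (monomial-pos β 0<x))
             (subst (λ a → _ ≤ a * monomial α x) (x<0⇒∣x∣≡-x c c<0) h)) }) dom)))
      (subst (λ n → fromℕ (suc n) ≤ M) (sym (trans (Listₚ.length-map -_ (map (evalT x) ts)) (Listₚ.length-map (evalT x) ts))) few)))
    where
    negated : ∀ x → - c * monomial α x + sum (map -_ (map (evalT x) ts)) ≡ - evalTs x ((c , α) ∷ ts)
    negated x = trans (cong₂ _+_ (sym (-‿distribˡ-* c _)) (sum-neg (map (evalT x) ts))) (-‿+-comm _ _)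
  ... | zer , refl = zer , λ x 0<x dom →
    sum-zero (zeroˡ _ ∷ Allₚ.map⁺ (All.map (λ { {d , β} h → vanishes x 0<x d β h }) dom))
    where
    vanishes : ∀ x → (∀ i → 0r < x i) → ∀ d β → M * (abs d * monomial β x) ≤ abs 0r * monomial α x → d * monomial β x ≡ 0r
    vanishes x 0<x d β h = trans (cong (_* monomial β x) (∣x∣≤0⇒x≡0 d (*-cancelʳ-≤ (monomial-pos β 0<x) (begin
      abs d * monomial β x          ≤⟨ x≤1*x 1≤M (0≤* (0≤∣x∣ d) (<⇒≤ (monomial-pos β 0<x))) ⟩
      M * (abs d * monomial β x)    ≤⟨ h ⟩
      abs 0r * monomial α x         ≡⟨ cong (_* monomial α x) ∣0∣≡0 ⟩
      0r * monomial α x             ≡⟨ trans (zeroˡ _) (sym (zeroˡ _)) ⟩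
      0r * monomial β x             ∎)))) (zeroˡ _)
      where
      ∣0∣≡0 : abs 0r ≡ 0r
      ∣0∣≡0 with compare 0r 0r
      ... | tri< 0<0 _ _ = ⊥-elim (<-irrefl refl 0<0)
      ... | tri≈ _ _ _   = refl
      ... | tri> _ _ 0<0 = ⊥-elim (<-irrefl refl 0<0)

  sum-↭ : ∀ {xs ys} → xs ↭ ys → sum xs ≡ sum ys
  sum-↭ _↭_.refl           = refl
  sum-↭ (_↭_.prep x p)     = cong (x +_) (sum-↭ p)
  sum-↭ (_↭_.swap x y p)   = trans (cong (λ s → x + (y + s)) (sum-↭ p)) (solve 3 (λ x y s → x :+ (y :+ s) := y :+ (x :+ s)) refl x y _)
  sum-↭ (_↭_.trans p q)    = trans (sum-↭ p) (sum-↭ q)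

  sum-++ : ∀ xs ys → sum (xs ++ ys) ≡ sum xs + sum ys
  sum-++ []       ys = sym (+-identityˡ _)
  sum-++ (x ∷ xs) ys = trans (cong (x +_) (sum-++ xs ys)) (sym (+-assoc x _ _))

  _·_ : ∀ {k} → Term k → Term k → Term k
  (c , α) · (d , β) = c * d , zipWith ℕ._+_ α β

  evalT-· : ∀ {k} (x : Fin k → Carrier) t u → evalT x (t · u) ≡ evalT x t * evalT x u
  evalT-· x (c , α) (d , β) = trans (cong ((c * d) *_) (monomial-+ α β x))
    (solve 4 (λ c d m n → (c :* d) :* (m :* n) := (c :* m) :* (d :* n)) refl c d _ _)

  evalTs-++ : ∀ {k} (x : Fin k → Carrier) ts us → evalTs x (ts ++ us) ≡ evalTs x ts + evalTs x us
  evalTs-++ x ts us = trans (cong sum (Listₚ.map-++ (evalT x) ts us)) (sum-++ (map (evalT x) ts) (map (evalT x) us))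

  evalTs-map-· : ∀ {k} (x : Fin k → Carrier) t us → evalTs x (map (t ·_) us) ≡ evalT x t * evalTs x us
  evalTs-map-· x t []       = sym (zeroʳ _)
  evalTs-map-· x t (u ∷ us) = trans (cong₂ _+_ (evalT-· x t u) (evalTs-map-· x t us)) (sym (distribˡ _ _ _))

  evalTs-product : ∀ {k} (x : Fin k → Carrier) ts us → evalTs x (cartesianProductWith _·_ ts us) ≡ evalTs x ts * evalTs x us
  evalTs-product x []       us = sym (zeroˡ _)
  evalTs-product x (t ∷ ts) us = trans (evalTs-++ x (map (t ·_) us) _)
    (trans (cong₂ _+_ (evalTs-map-· x t us) (evalTs-product x ts us)) (sym (distribʳ _ _ _)))

  monomial-zeros : ∀ {k} (x : Fin k → Carrier) → monomial (replicate k 0) x ≡ 1r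
  monomial-zeros {zero}  x = refl
  monomial-zeros {suc k} x = trans (*-identityˡ _) (monomial-zeros (x ∘ suc))

  monomial-unit : ∀ {k} (i : Fin k) (x : Fin k → Carrier) → monomial (replicate k 0 [ i ]≔ 1) x ≡ x i
  monomial-unit zero    x = trans (cong₂ _*_ (*-identityʳ _) (monomial-zeros (x ∘ suc))) (*-identityʳ _)
  monomial-unit (suc i) x = trans (*-identityˡ _) (monomial-unit i (x ∘ suc))

  -- The terms of p (t + s y) as a polynomial in y, without collecting them.
  expand : Carrier → Carrier → ∀ {k} → Poly k → List (Term k)
  expand t s {k} (const q) = (fromℚ q , replicate k 0) ∷ []
  expand t s {k} (var i)   = (t , replicate k 0) ∷ (s , replicate k 0 [ i ]≔ 1) ∷ []
  expand t s     (p ⊕ q)   = expand t s p ++ expand t s q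
  expand t s     (p ⊗ q)   = cartesianProductWith _·_ (expand t s p) (expand t s q)

  evalTs-expand : ∀ t s {k} (p : Poly k) {x y} → (∀ i → x i ≡ t + s * y i) → evalTs y (expand t s p) ≡ evalP p x
  evalTs-expand t s (const q) {y = y} eq = trans (+-identityʳ _) (trans (cong (fromℚ q *_) (monomial-zeros y)) (*-identityʳ _))
  evalTs-expand t s (var i)   {y = y} eq = trans (cong₂ _+_ (trans (cong (t *_) (monomial-zeros y)) (*-identityʳ t))
    (trans (+-identityʳ _) (cong (s *_) (monomial-unit i y)))) (sym (eq i))
  evalTs-expand t s (p ⊕ q)   {y = y} eq = trans (evalTs-++ y (expand t s p) _) (cong₂ _+_ (evalTs-expand t s p eq) (evalTs-expand t s q eq))
  evalTs-expand t s (p ⊗ q)   {y = y} eq = trans (evalTs-product y (expand t s p) _) (cong₂ _*_ (evalTs-expand t s p eq) (evalTs-expand t s q eq))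

  length-expand : ∀ t s {k} (p : Poly k) → length (expand t s p) ≡ size p
  length-expand t s (const q) = refl
  length-expand t s (var i)   = refl
  length-expand t s (p ⊕ q)   = trans (Listₚ.length-++ (expand t s p)) (cong₂ ℕ._+_ (length-expand t s p) (length-expand t s q))
  length-expand t s (p ⊗ q)   = trans (length-cartesianProductWith _·_ (expand t s p) _) (cong₂ ℕ._*_ (length-expand t s p) (length-expand t s q))

  OfDegree : ℕ → ∀ {k} → Term k → Set
  OfDegree n (_ , α) = Vec.sum α ℕ.≤ n

  expand-degree : ∀ t s {k} (p : Poly k) → All (OfDegree (degree p)) (expand t s p)
  expand-degree t s {k} (const q) = ℕₚ.≤-reflexive (sum-zeros k) ∷ []
  expand-degree t s {k} (var i)   = subst (ℕ._≤ 1) (sym (sum-zeros k)) z≤n ∷ ℕₚ.≤-reflexive (sum-unit i) ∷ []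
  expand-degree t s (p ⊕ q) = Allₚ.++⁺ (All.map (λ h → ℕₚ.≤-trans h (ℕₚ.m≤m+n _ _)) (expand-degree t s p))
                                       (All.map (λ h → ℕₚ.≤-trans h (ℕₚ.m≤n+m _ _)) (expand-degree t s q))
  expand-degree t s (p ⊗ q) = products (expand-degree t s p)
    where
    products : ∀ {ts} → All (OfDegree (degree p)) ts → All (OfDegree (degree p ℕ.+ degree q)) (cartesianProductWith _·_ ts (expand t s q))
    products []                = []
    products {(_ , α) ∷ _} (h ∷ hs) = Allₚ.++⁺ (Allₚ.map⁺ (All.map (λ { {(_ , β)} h′ → subst (ℕ._≤ _) (sym (sum-zipWith-+ α β)) (ℕₚ.+-mono-≤ h h′) }) (expand-degree t s q))) (products hs)

  -- Like terms must be merged: no choice of scales separates equal exponent vectors, and their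
  -- coefficients may cancel.
  add : ∀ {k} → Term k → List (Term k) → List (Term k)
  add t []                     = t ∷ []
  add (c , α) ((d , β) ∷ ts) with Vecₚ.≡-dec ℕ._≟_ α β
  ... | yes _ = (c + d , β) ∷ ts
  ... | no  _ = (d , β) ∷ add (c , α) ts

  collect : ∀ {k} → List (Term k) → List (Term k)
  collect = foldr add []

  evalTs-add : ∀ {k} (x : Fin k → Carrier) t ts → evalTs x (add t ts) ≡ evalT x t + evalTs x ts
  evalTs-add x t [] = refl
  evalTs-add x (c , α) ((d , β) ∷ ts) with Vecₚ.≡-dec ℕ._≟_ α β
  ... | yes refl = trans (cong (_+ evalTs x ts) (distribʳ _ c d)) (+-assoc _ _ _)
  ... | no  _    = trans (cong (d * monomial β x +_) (evalTs-add x (c , α) ts))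
                     (solve 3 (λ u v w → u :+ (v :+ w) := v :+ (u :+ w)) refl _ _ _)

  evalTs-collect : ∀ {k} (x : Fin k → Carrier) ts → evalTs x (collect ts) ≡ evalTs x ts
  evalTs-collect x []       = refl
  evalTs-collect x (t ∷ ts) = trans (evalTs-add x t (collect ts)) (cong (evalT x t +_) (evalTs-collect x ts))

  length-add : ∀ {k} (t : Term k) ts → length (add t ts) ℕ.≤ suc (length ts)
  length-add t [] = ℕₚ.≤-refl
  length-add (c , α) ((d , β) ∷ ts) with Vecₚ.≡-dec ℕ._≟_ α β
  ... | yes _ = ℕₚ.n≤1+n _
  ... | no  _ = s≤s (length-add (c , α) ts)

  length-collect : ∀ {k} (ts : List (Term k)) → length (collect ts) ℕ.≤ length ts
  length-collect []       = z≤n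
  length-collect (t ∷ ts) = ℕₚ.≤-trans (length-add t (collect ts)) (s≤s (length-collect ts))

  All-add : ∀ {k} {P : Vec ℕ k → Set} {t ts} → P (proj₂ t) → All (P ∘ proj₂) ts → All (P ∘ proj₂) (add t ts)
  All-add {ts = []} p [] = p ∷ []
  All-add {t = (c , α)} {(d , β) ∷ ts} p (q ∷ qs) with Vecₚ.≡-dec ℕ._≟_ α β
  ... | yes _ = q ∷ qs
  ... | no  _ = q ∷ All-add p qs

  All-collect : ∀ {k} {P : Vec ℕ k → Set} {ts} → All (P ∘ proj₂) ts → All (P ∘ proj₂) (collect ts)
  All-collect []       = []
  All-collect (p ∷ ps) = All-add p (All-collect ps)

  Distinct : ∀ {k} → Rel (Term k) 0ℓ
  Distinct t u = proj₂ t ≢ proj₂ u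

  add-distinct : ∀ {k} (t : Term k) {ts} → AllPairs Distinct ts → AllPairs Distinct (add t ts)
  add-distinct t [] = [] ∷ []
  add-distinct (c , α) {(d , β) ∷ ts} (p ∷ ps) with Vecₚ.≡-dec ℕ._≟_ α β
  ... | yes _  = p ∷ ps
  ... | no α≢β = All-add {P = β ≢_} (α≢β ∘ sym) p ∷ add-distinct (c , α) ps

  collect-distinct : ∀ {k} (ts : List (Term k)) → AllPairs Distinct (collect ts)
  collect-distinct []       = []
  collect-distinct (t ∷ ts) = add-distinct t (collect-distinct ts)

  fromℕ-mono : ∀ {m n} → m ℕ.≤ n → fromℕ m ≤ fromℕ n
  fromℕ-mono {n = zero}  z≤n       = ≤-refl
  fromℕ-mono {n = suc n} z≤n       = ≤-trans (fromℕ-mono {n = n} z≤n) (subst (_≤ 1r + fromℕ n) (+-identityˡ (fromℕ n)) (+-monoˡ-≤ (fromℕ n) 0≤1))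
  fromℕ-mono             (s≤s m≤n) = +-monoʳ-≤ 1r (fromℕ-mono m≤n)

  -- Constant sign of one polynomial on separated scales.

  ConstantSign : {A : Set} → (A → Carrier) → ∀ {k} → Poly k → List A → Set
  ConstantSign {A} v {k} p l = ∃ λ σ → ∀ (e : Fin k → A) → tabulate e ⊆ l → HasSign σ (evalP p (v ∘ e))

  ConstantSign-hereditary : {A : Set} (v : A → Carrier) → ∀ {k} (p : Poly k) → Hereditary (ConstantSign v p)
  ConstantSign-hereditary v p s (σ , h) = σ , λ e t → h e (⊆-trans t s)

  module _ {A : Set} (M : Carrier) (E : ℕ) (1≤M : 1r ≤ M) {l₀ : List A} {v δ : A → Carrier} {t s : Carrier}
           (affine : ∀ x → v x ≡ t + s * δ x) (positive : All (λ x → 0r < δ x) l₀)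
           (separated : Separated M E 1≤M δ l₀) where

    private
      _≽[_]_ : ∀ {k} → Term k → List A → Term k → Set
      (c , α) ≽[ l ] (d , β) = Dominated M E 1≤M δ l (abs d) β (abs c) α

      ≽-trans : ∀ {k l} → l ⊆ l₀ → Transitive {A = Term k} (_≽[ l ]_)
      ≽-trans l⊆ {c , α} {d , β} {f , γ} t≽u u≽w e s = ≤-trans (u≽w e s) (≤-trans
        (x≤1*x 1≤M (0≤* (0≤∣x∣ d) (<⇒≤ (monomial-pos β (Allₚ.tabulate⁻ (All-resp-⊆ (⊆-trans s l⊆) positive)))))) (t≽u e s))

      -- All ordered pairs are treated, diagonal included, since their number is a plain product.
      -- The equality alternative settles the diagonal; for distinct collected terms it cannot
      -- occur.
      Resolved : ∀ {k} → Term k × Term k → List A → Set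
      Resolved ((c , α) , (d , β)) l = α ≡ β ⊎ Comparable M E 1≤M δ (abs c) α (abs d) β l

      Resolved-hereditary : ∀ {k} (tu : Term k × Term k) → Hereditary (Resolved tu)
      Resolved-hereditary ((c , α) , (d , β)) s = Sum.map₂ (Comparable-hereditary M E 1≤M δ (abs c) α (abs d) β s)

      resolve : ∀ {k} {tu : Term k × Term k} → OfDegree E (proj₁ tu) → OfDegree E (proj₂ tu) → Refinable l₀ 2 (Resolved tu)
      resolve {tu = (c , α) , (d , β)} α≤E β≤E m {l} s long with Vecₚ.≡-dec ℕ._≟_ α β
      ... | yes α≡β = l , ⊆-refl , ℕₚ.≤-trans (ℕₚ.m≤n*m m 2) long , inj₁ α≡β
      ... | no α≢β =
        let (l′ , s′ , long′ , cmp) = separated α β α≢β α≤E β≤E (0≤∣x∣ c) (0≤∣x∣ d) m s long in l′ , s′ , long′ , inj₂ cmp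

    -- At most `size p` collected terms form at most `size p * size p` ordered pairs, each costing a
    -- factor of two. On the refined list domination compares any two terms and is transitive, so
    -- one term dominates all others; permuting it to the front leaves the value unchanged and fixes
    -- the sign.
    refinable-sign : ∀ {k} (p : Poly k) → degree p ℕ.≤ E → fromℕ (size p) ≤ M →
                     Refinable l₀ (2 ℕ.^ (size p ℕ.* size p)) (ConstantSign v p)
    refinable-sign {k} p deg≤E size≤M m {l} sub long
      with refinable-mono {P = λ l → All (λ tu → Resolved tu l) pairs} pairs-bound
             (refine-all {P = Resolved} {c = λ _ → 2} Resolved-hereditary
               (All.tabulate λ tu∈ → let (t∈ , u∈) = ∈-cartesianProduct⁻ ts ts tu∈ in
                  resolve (All.lookup of-degree t∈) (All.lookup of-degree u∈)))
             m sub long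
      where
      ts = collect (expand t s p)
      pairs = cartesianProduct ts ts
      of-degree : All (OfDegree E) ts
      of-degree = All-collect {P = λ α → Vec.sum α ℕ.≤ E} (All.map (λ h → ℕₚ.≤-trans h deg≤E) (expand-degree t s p))
      few : length ts ℕ.≤ size p
      few = ℕₚ.≤-trans (length-collect (expand t s p)) (ℕₚ.≤-reflexive (length-expand t s p))
      pairs-bound : product (map (λ _ → 2) pairs) ℕ.≤ 2 ℕ.^ (size p ℕ.* size p)
      pairs-bound = ℕₚ.≤-trans (ℕₚ.≤-reflexive (trans (product-const 2 pairs) (cong (2 ℕ.^_) (length-cartesianProductWith _,_ ts ts))))
                      (ℕₚ.^-monoʳ-≤ 2 (ℕₚ.*-mono-≤ few few))
    ... | l′ , s′ , long′ , resolved = l′ , s′ , long′ , constant (maximum (λ {x} {y} {z} → ≽-trans (⊆-trans s′ sub) {x} {y} {z}) compared)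
      where
      ts = collect (expand t s p)
      compared : AllPairs (λ t u → t ≽[ l′ ] u ⊎ u ≽[ l′ ] t) ts
      compared = AllPairs-map-All (λ t∈ u∈ t≢u → Sum.[ ⊥-elim ∘ t≢u , Sum.swap ] (All.lookup resolved (∈-cartesianProduct⁺ t∈ u∈)))
                   (All.tabulate id) (collect-distinct (expand t s p))
      eval : ∀ e → evalTs (δ ∘ e) ts ≡ evalP p (v ∘ e)
      eval e = trans (evalTs-collect (δ ∘ e) (expand t s p)) (evalTs-expand t s p (affine ∘ e))
      constant : ts ≡ [] ⊎ (∃₂ λ y ys → ts ↭ y ∷ ys × All (y ≽[ l′ ]_) ys) → ConstantSign v p l′
      constant (inj₁ none) = zer , λ e _ → trans (sym (eval e)) (cong (evalTs (δ ∘ e)) none)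
      constant (inj₂ (y , ys , perm , top)) =
        let (σ , has-sign) = leading-sign M 1≤M y ys (≤-trans (fromℕ-mono (subst (ℕ._≤ size p) (↭-length perm)
                               (ℕₚ.≤-trans (length-collect (expand t s p)) (ℕₚ.≤-reflexive (length-expand t s p))))) size≤M)
        in σ , λ e sub′ → subst (HasSign σ) (trans (sym (sum-↭ (↭-map⁺ (evalT (δ ∘ e)) perm))) (eval e))
                 (has-sign (δ ∘ e) (Allₚ.tabulate⁻ (All-resp-⊆ (⊆-trans sub′ (⊆-trans s′ sub)) positive)) (All.map (λ h → h e sub′) top))

-- Constant sign of all polynomials in the predicates.

f≤sum : {X : Set} (f : X → ℕ) (xs : List X) → All (λ x → f x ℕ.≤ ListAction.sum (map f xs)) xs
f≤sum f []       = []
f≤sum f (x ∷ xs) = ℕₚ.m≤m+n (f x) _ ∷ All.map (λ h → ℕₚ.≤-trans h (ℕₚ.m≤n+m _ (f x))) (f≤sum f xs)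

rename : ∀ {k n} → (Fin k → Fin n) → Poly k → Poly n
rename ρ (const q) = const q
rename ρ (var i)   = var (ρ i)
rename ρ (p ⊕ q)   = rename ρ p ⊕ rename ρ q
rename ρ (p ⊗ q)   = rename ρ p ⊗ rename ρ q

AnyPoly : Set
AnyPoly = Σ ℕ Poly

-- Reversing a decreasing list presents its tuples backwards; reading the variables backwards
-- compensates.
mirror : AnyPoly → AnyPoly
mirror (k , p) = k , rename opposite p

withMirrors : List AnyPoly → List AnyPoly
withMirrors ps = ps ++ map mirror ps

-- One `M` and one `E` must suit every polynomial, which the sums ensure. The refinements follow one
-- another, so their costs multiply.
sizes degrees weight : List AnyPoly → ℕ
sizes   = ListAction.sum ∘ map (λ (_ , p) → size p)
degrees = ListAction.sum ∘ map (λ (_ , p) → degree p)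
weight  = product ∘ map (λ (_ , p) → 2 ℕ.^ (size p ℕ.* size p))

1≤weight : ∀ ps → 1 ℕ.≤ weight ps
1≤weight []             = ℕₚ.≤-refl
1≤weight ((_ , p) ∷ ps) = ℕₚ.*-mono-≤ (ℕₚ.m^n>0 2 (size p ℕ.* size p)) (1≤weight ps)

ramseyLength : List AnyPoly → ℕ → ℕ
ramseyLength ps m = extractionLength (sizes ps) (degrees ps) (weight ps ℕ.* m)

atoms : ∀ {k} → Formula k → List (Poly k)
atoms (p ≐0)    = p ∷ []
atoms (p >0)    = p ∷ []
atoms (¬ᶠ φ)    = atoms φ
atoms (φ ∧ᶠ ψ)  = atoms φ ++ atoms ψ
atoms (φ ∨ᶠ ψ)  = atoms φ ++ atoms ψ

anyAtoms : Predicate → List AnyPoly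
anyAtoms (k , φ) = map (k ,_) (atoms φ)

allAtoms : List Predicate → List AnyPoly
allAtoms = concatMap anyAtoms

arities : List Predicate → ℕ
arities = ListAction.sum ∘ map proj₁

module Ramsey (ℝ : RealField) where
  open OrderedField ℝ
  open Polynomials ℝ using (HasSign; sign; ConstantSign; ConstantSign-hereditary; refinable-sign; fromℕ-mono)

  evalP-cong : ∀ {k} (p : Poly k) {x y} → (∀ i → x i ≡ y i) → evalP p x ≡ evalP p y
  evalP-cong (const q) eq = refl
  evalP-cong (var i)   eq = eq i
  evalP-cong (p ⊕ q)   eq = cong₂ _+_ (evalP-cong p eq) (evalP-cong q eq)
  evalP-cong (p ⊗ q)   eq = cong₂ _*_ (evalP-cong p eq) (evalP-cong q eq)

  evalP-rename : ∀ {k n} (ρ : Fin k → Fin n) (p : Poly k) x → evalP (rename ρ p) x ≡ evalP p (x ∘ ρ)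
  evalP-rename ρ (const q) x = refl
  evalP-rename ρ (var i)   x = refl
  evalP-rename ρ (p ⊕ q)   x = cong₂ _+_ (evalP-rename ρ p x) (evalP-rename ρ q x)
  evalP-rename ρ (p ⊗ q)   x = cong₂ _*_ (evalP-rename ρ p x) (evalP-rename ρ q x)

  constant-sequence : {A : Set} (v : A → Carrier) {l : List A} → 1 ℕ.≤ length l → AllPairs (λ x y → v x ≡ v y) l →
                      ∀ {k} (p : Poly k) → ConstantSign v p l
  constant-sequence v {x ∷ l} _ (same ∷ _) p =
    let (σ , has-sign) = sign (evalP p (λ _ → v x))
    in σ , λ e s → subst (HasSign σ) (evalP-cong p (Allₚ.tabulate⁻ (All-resp-⊆ s (refl ∷ same)))) has-sign

  oriented-ramsey : ∀ {N} (v : Fin N → Carrier) ps m → 1 ℕ.≤ m → ramseyLength ps m ℕ.≤ N →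
    ∃ λ (l : List (Fin N)) → Oriented Fin._<_ l × m ℕ.≤ length l × All (λ (_ , p) → ConstantSign v p l) ps
  oriented-ramsey {N} v ps m 1≤m long
    with separated-sublist v (sizes ps) (degrees ps) (weight ps ℕ.* m) {allFin N}
           (inj₁ (AllPairsₚ.tabulate⁺-< id)) (subst (ramseyLength ps m ℕ.≤_) (sym (Listₚ.length-tabulate {n = N} id)) long)
    where open Extraction ℝ {Fin N} {Fin._<_} using (separated-sublist)
  ... | l , ori , long₁ , inj₁ same =
    l , ori , m≤l , All.tabulate (λ {(_ , p)} _ → constant-sequence v (ℕₚ.≤-trans 1≤m m≤l) same p)
    where m≤l = ℕₚ.≤-trans (ℕₚ.m≤n*m m (weight ps) {{ℕ.>-nonZero (1≤weight ps)}}) long₁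
  ... | l , ori , long₁ , inj₂ (δ , (t , s , affine) , positive , separated) =
    let (l′ , sub , long′ , signs) = refine-all {P = λ (_ , p) → ConstantSign v p} {c = λ (_ , p) → 2 ℕ.^ (size p ℕ.* size p)}
          (λ (_ , p) → ConstantSign-hereditary v p)
          (All.zipWith (λ { {_ , p} (deg≤ , size≤) →
              refinable-sign M (degrees ps) 1≤M affine positive separated p deg≤ (size≤M size≤) })
            (f≤sum (λ (_ , p) → degree p) ps , f≤sum (λ (_ , p) → size p) ps))
          m ⊆-refl long₁
    in l′ , Oriented-⊆ sub ori , long′ , signs
    where
    -- The value that `sizes ps` rounds of `ratio-thin` deliver; it is at least the number of terms
    -- of each polynomial, as `leading-sign` requires.
    M = 2r ^ (2 ℕ.^ sizes ps)
    1≤M : 1r ≤ M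
    1≤M = 1≤^ (2 ℕ.^ sizes ps) 1≤2
    size≤M : ∀ {n} → n ℕ.≤ sizes ps → fromℕ n ≤ M
    size≤M n≤ = ≤-trans (fromℕ-mono n≤) (≤-trans (fromℕ≤2^ (sizes ps)) (^-monoʳ-≤ 1≤2 (n≤2^n (sizes ps))))

  ramsey : ∀ {N} (v : Fin N → Carrier) ps m → 1 ℕ.≤ m → ramseyLength (withMirrors ps) m ℕ.≤ N →
    ∃ λ (l : List (Fin N)) → AllPairs Fin._<_ l × m ℕ.≤ length l × All (λ (_ , p) → ConstantSign v p l) ps
  ramsey v ps m 1≤m long with oriented-ramsey v (withMirrors ps) m 1≤m long
  ... | l , inj₁ inc , long′ , signs = l , inc , long′ , Allₚ.++⁻ˡ ps signs
  ... | l , inj₂ dec , long′ , signs =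
    reverse l , AllPairs-reverse dec , subst (m ℕ.≤_) (sym (Listₚ.length-reverse l)) long′ ,
    All.map (λ { {_ , p} (σ , h) → σ , λ e s → subst (HasSign σ)
        (trans (evalP-rename opposite p _) (evalP-cong p (λ i → cong (v ∘ e) (Finₚ.opposite-involutive i))))
        (h (e ∘ opposite) (subst (_⊆ l) (reverse-tabulate e) (reverse-⊆ s))) })
      (Allₚ.map⁻ (Allₚ.++⁻ʳ ps signs))

  SameSign : Carrier → Carrier → Set
  SameSign x y = ∃ λ σ → HasSign σ x × HasSign σ y

  -- Truth depends only on the signs of the atoms. `SameSign` is symmetric, and negation uses this
  -- to exchange the two points.
  same-truth : ∀ {k} (φ : Formula k) {x y} → All (λ p → SameSign (evalP p x) (evalP p y)) (atoms φ) → ⟦ φ ⟧ x → ⟦ φ ⟧ y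
  same-truth (p ≐0) ((neg , x<0 , _) ∷ []) x≡0 = ⊥-elim (<-irrefl x≡0 x<0)
  same-truth (p ≐0) ((zer , _ , y≡0) ∷ []) _   = y≡0
  same-truth (p ≐0) ((pos , 0<x , _) ∷ []) x≡0 = ⊥-elim (<-irrefl (sym x≡0) 0<x)
  same-truth (p >0) ((neg , x<0 , _) ∷ []) 0<x = ⊥-elim (<-irrefl refl (<-trans x<0 0<x))
  same-truth (p >0) ((zer , x≡0 , _) ∷ []) 0<x = ⊥-elim (<-irrefl (sym x≡0) 0<x)
  same-truth (p >0) ((pos , _ , 0<y) ∷ []) _   = 0<y
  same-truth (¬ᶠ φ)   same ¬φx      = ¬φx ∘ same-truth φ (All.map (λ (σ , x , y) → σ , y , x) same)
  same-truth (φ ∧ᶠ ψ) same (φx , ψx) = same-truth φ (Allₚ.++⁻ˡ (atoms φ) same) φx , same-truth ψ (Allₚ.++⁻ʳ (atoms φ) same) ψx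
  same-truth (φ ∨ᶠ ψ) same = Sum.map (same-truth φ (Allₚ.++⁻ˡ (atoms φ) same)) (same-truth ψ (Allₚ.++⁻ʳ (atoms φ) same))

  allAtoms-lookup : ∀ {P : AnyPoly → Set} Φs → All P (allAtoms Φs) → ∀ {k φ} → (k , φ) ∈ Φs → All (λ p → P (k , p)) (atoms φ)
  allAtoms-lookup (Φ ∷ Φs) ps (here refl) = Allₚ.map⁻ (Allₚ.++⁻ˡ (anyAtoms Φ) ps)
  allAtoms-lookup (Φ ∷ Φs) ps (there Φ∈)  = allAtoms-lookup Φs (Allₚ.++⁻ʳ (anyAtoms Φ) ps) Φ∈

-- From one true instance to all increasing tuples.

inject≤-increasing : ∀ {m n} (m≤n : m ℕ.≤ n) → Increasing (λ i → inject≤ i m≤n)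
inject≤-increasing m≤n i j i<j = subst₂ ℕ._<_ (sym (Finₚ.toℕ-inject≤ i m≤n)) (sym (Finₚ.toℕ-inject≤ j m≤n)) i<j

module Transfer (ℝ : RealField) where
  open OrderedField ℝ using (Carrier; ⟦_⟧)
  open ErdosSzekeres ℝ
  open Polynomials ℝ using (ConstantSign)
  open Ramsey ℝ

  module _ (Φs : List Predicate) {N₀ : ℕ} (works : Works Φs (arities Φs) N₀) where

    -- The property is invoked at the sum of the arities, so whichever predicate it returns has an
    -- increasing tuple `κ` in the sample. Length `N₀ + n` leaves room both for the sample and for
    -- the `n` terms sought; constant signs carry the truth at `κ` to every tuple of these.
    works-from-arities : ∀ n N → 1 ℕ.≤ n → ramseyLength (withMirrors (allAtoms Φs)) (N₀ ℕ.+ n) ℕ.≤ N → Works Φs n N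
    works-from-arities n N 1≤n long a
      with ramsey a (allAtoms Φs) (N₀ ℕ.+ n) (ℕₚ.≤-trans 1≤n (ℕₚ.m≤n+m n N₀)) long
    ... | l , inc , long′ , signs = σ , σ-increasing , lose Φ∈ everywhere
      where
      n≤l : n ℕ.≤ length l
      n≤l = ℕₚ.≤-trans (ℕₚ.m≤n+m n N₀) long′
      N₀≤l : N₀ ℕ.≤ length l
      N₀≤l = ℕₚ.≤-trans (ℕₚ.m≤m+n N₀ n) long′
      σ : Fin n → Fin N
      σ i = lookup l (inject≤ i n≤l)
      σ-increasing : StrictlyIncreasing σ
      σ-increasing i j i<j = lookup-AllPairs inc _ _ (inject≤-increasing n≤l i j i<j)
      sample = works (λ i → a (lookup l (inject≤ i N₀≤l)))
      τ = proj₁ sample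
      found = find (proj₂ (proj₂ sample))
      k = proj₁ (proj₁ found)
      φ = proj₂ (proj₁ found)
      Φ∈ : (k , φ) ∈ Φs
      Φ∈ = proj₁ (proj₂ found)
      k≤ : k ℕ.≤ arities Φs
      k≤ = All.lookup (f≤sum proj₁ Φs) Φ∈
      κ : Fin k → Fin (length l)
      κ i = inject≤ (τ (inject≤ i k≤)) N₀≤l
      κ-increasing : Increasing κ
      κ-increasing i j i<j = inject≤-increasing N₀≤l _ _ (proj₁ (proj₂ sample) _ _ (inject≤-increasing k≤ i j i<j))
      φκ : ⟦ φ ⟧ (a ∘ lookup l ∘ κ)
      φκ = proj₂ (proj₂ found) (λ i → inject≤ i k≤) (inject≤-increasing k≤)
      everywhere : HoldsEverywhere (k , φ) (a ∘ σ)
      everywhere ι ι-inc = same-truth φ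
        (All.map (λ (s , h) → s , h (lookup l ∘ κ) (tabulate-lookup-⊆ l κ κ-increasing) ,
                                  h (σ ∘ ι) (tabulate-lookup-⊆ l _ (λ i j i<j → inject≤-increasing n≤l _ _ (ι-inc i j i<j))))
          (allAtoms-lookup Φs signs Φ∈))
        φκ

-- The double exponential bound.

open import Data.Nat using (_+_; _*_; _^_; _≤_)

-- With `d` the doubling length, cubing `2 ^ (d + d)` and adding one costs at most `8 * d` in the
-- exponent, which gives 3 of the 4; the fourth absorbs the `suc` inside `d`. The factor 2 is the
-- exponent `s + s` of the squaring stage, and `N₀ + 1` comes from `N₀ + n ≤ (N₀ + 1) * n` for
-- positive `n`.
ramseyConstant : List AnyPoly → ℕ → ℕ
ramseyConstant ps N₀ = 4 + sizes ps + 2 * (2 ^ (2 + degrees ps) * (weight ps * (N₀ + 1)))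

ramseyLength-bound : ∀ ps N₀ n → 1 ≤ n → ramseyLength ps (N₀ + n) ≤ 2 ^ (2 ^ (ramseyConstant ps N₀ * n))
ramseyLength-bound ps N₀ n 1≤n = begin
  suc (q * (q * q))                    ≡⟨ cong suc cube ⟩
  suc (2 ^ e)                          ≤⟨ ℕₚ.+-monoˡ-≤ (2 ^ e) (ℕₚ.m^n>0 2 e) ⟩
  2 ^ e + 2 ^ e                        ≡⟨ 2^-suc e ⟨
  2 ^ suc e                            ≤⟨ ℕₚ.^-monoʳ-≤ 2 (begin
    1 + e                                ≤⟨ ℕₚ.+-monoˡ-≤ e 1≤d ⟩
    d + e                                ≤⟨ ℕₚ.m≤m+n (d + e) d ⟩
    (d + e) + d
      ≡⟨ solve 1 (λ d → (d :+ ((d :+ d) :+ ((d :+ d) :+ (d :+ d)))) :+ d := con 8 :* d) refl d ⟩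
    2 ^ 3 * (2 ^ j * suc (2 ^ (s + s)))
      ≤⟨ ℕₚ.*-monoʳ-≤ (2 ^ 3) (ℕₚ.*-monoʳ-≤ (2 ^ j) (ℕₚ.+-monoˡ-≤ (2 ^ (s + s)) (ℕₚ.m^n>0 2 (s + s)))) ⟩
    2 ^ 3 * (2 ^ j * (2 ^ (s + s) + 2 ^ (s + s))) ≡⟨ cong (λ x → 2 ^ 3 * (2 ^ j * x)) (2^-suc (s + s)) ⟨
    2 ^ 3 * (2 ^ j * 2 ^ suc (s + s))    ≡⟨ cong (2 ^ 3 *_) (ℕₚ.^-distribˡ-+-* 2 j (suc (s + s))) ⟨
    2 ^ 3 * 2 ^ (j + suc (s + s))        ≡⟨ ℕₚ.^-distribˡ-+-* 2 3 (j + suc (s + s)) ⟨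
    2 ^ (3 + (j + suc (s + s)))          ≤⟨ ℕₚ.^-monoʳ-≤ 2 exponent ⟩
    2 ^ (ramseyConstant ps N₀ * n)       ∎) ⟩
  2 ^ (2 ^ (ramseyConstant ps N₀ * n)) ∎
  where
  open ℕₚ.≤-Reasoning
  open ℕ-Solver.+-*-Solver using (solve; _:+_; _:*_; _:=_; con)
  j = sizes ps
  a = 2 ^ (2 + degrees ps)
  w = weight ps
  s = a * (w * (N₀ + n))
  d = 2 ^ j * suc (2 ^ (s + s))
  q = 2 ^ (d + d)
  e = (d + d) + ((d + d) + (d + d))
  1≤d : 1 ≤ d
  1≤d = ℕₚ.*-mono-≤ (ℕₚ.m^n>0 2 j) (s≤s z≤n)
  cube : q * (q * q) ≡ 2 ^ e
  cube = trans (cong (q *_) (sym (ℕₚ.^-distribˡ-+-* 2 (d + d) (d + d)))) (sym (ℕₚ.^-distribˡ-+-* 2 (d + d) _))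
  1≤n⇒m≤m*n : ∀ m → m ≤ m * n
  1≤n⇒m≤m*n m = ℕₚ.m≤m*n m n {{ℕ.>-nonZero 1≤n}}
  exponent : 3 + (j + suc (s + s)) ≤ ramseyConstant ps N₀ * n
  exponent = begin
    3 + (j + suc (s + s))
      ≡⟨ solve 2 (λ j s → con 3 :+ (j :+ (con 1 :+ (s :+ s))) := (con 4 :+ j) :+ con 2 :* s) refl j s ⟩
    (4 + j) + 2 * (a * (w * (N₀ + n)))
      ≤⟨ ℕₚ.+-mono-≤ (1≤n⇒m≤m*n (4 + j)) (ℕₚ.*-monoʳ-≤ 2 (ℕₚ.*-monoʳ-≤ a (ℕₚ.*-monoʳ-≤ w (ℕₚ.+-monoˡ-≤ n (1≤n⇒m≤m*n N₀))))) ⟩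
    (4 + j) * n + 2 * (a * (w * (N₀ * n + n)))
      ≡⟨ solve 5 (λ j a w m n → (con 4 :+ j) :* n :+ con 2 :* (a :* (w :* (m :* n :+ n)))
                                                                    := (con 4 :+ j :+ con 2 :* (a :* (w :* (m :+ con 1)))) :* n) refl j a w N₀ n ⟩
    ramseyConstant ps N₀ * n                          ∎

theorem4 : (ℝ : RealField) → (Φs : List Predicate) →
    ErdosSzekeres.IsErdosSzekeres ℝ Φs →
    ∃ λ (C : ℕ) → ∀ n → 1 ≤ n → ErdosSzekeres.ES≤ ℝ Φs n (2 ^ (2 ^ (C * n)))
theorem4 ℝ Φs isES =
  ramseyConstant ps N₀ , λ n 1≤n →
    N n , ℕₚ.≤-refl , Transfer.works-from-arities ℝ Φs works n (N n) 1≤n (ramseyLength-bound ps N₀ n 1≤n)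
  where
  ps = withMirrors (allAtoms Φs)
  N₀ = proj₁ (isES (arities Φs))
  works = proj₂ (isES (arities Φs))
  N : ℕ → ℕ
  N n = 2 ^ (2 ^ (ramseyConstant ps N₀ * n))
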